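{- Let $L$ be a label set, let $((X,d),l)$ be a finite metric space labeled with $L$, and let $\mathcal{H}$ be a universal center-based clustering objective for $L$, with cluster scoring function $H_l$. I. Suppose that $((X,d),\mathcal{H},k)$ is a clustering problem in which $\mathcal{H}$ is a universal center-based separable sum-objective. Then the scoring function $H_l$ can be represented as $$H_l(C,d)=\min_{c\in C}\Big(f_c+\sum_{x\in C}g_x(d(x,c))\Big)$$ for some function $f:X\to\mathbb{R}$, $c\mapsto f_c$, and some non-decreasing functions $g_x:\mathbb{R}^{\ge 0}\to\mathbb{R}$ ($x\in X$), such that the minimum is attained when $c$ is a center of $C$; and thus $\mathcal{H}(C_1,\dots,C_k;d)=\sum_{i=1}^kH_l(C_i,d|_{C_i})$ is a natural center-based objective. II. Suppose that $((X,d),\mathcal{H},k)$ is a clustering problem in which $\mathcal{H}$ is a universal center-based separable max-objective. If the cost of any singleton cluster $\{x\}$ equals $0$, then the scoring function $H_l$ can be represented as $$H_l(C,d)=\min_{c\in C}\ \max\Big(f_c,\ \max_{x\in C}g_x(d(x,c))\Big)$$ for some function $f:X\to\mathbb{R}$, $c\mapsto f_c$, and some non-decreasing functions $g_x:\mathbb{R}^{\ge 0}\to\mathbb{R}$ ($x\in X$), such that the minimum is attained when $c$ is a center of $C$; and thus $\mathcal{H}(C_1,\dots,C_k;d)=\max_{i\in\{1,\dots,k\}}H_l(C_i,d|_{C_i})$ is a natural center-based objective. In both parts the representation is for non-empty subsets $C\subset X$ and metrics $d$ on $C$, with the same $f$ and $g_x$ for all of them.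
   Context: Clustering problems. An instance of a clustering problem is a tuple $((X,d),\mathcal{H},k)$, where $(X,d)$ is a finite metric space, $k>1$ is an integer, and $\mathcal{H}$ (the objective) is a function that, given a partition of $X$ into $k$ (non-empty) sets $C_1,\dots,C_k$ and a metric $d$ on $X$, returns a nonnegative real number $\mathcal{H}(C_1,\dots,C_k;d)$. An optimal clustering is a partition minimizing $\mathcal{H}(C_1,\dots,C_k;d)$. Center-based and separable objectives. $\mathcal{H}$ is a center-based objective if: (1) to every non-empty subset $S\subset X$ and every metric $d_S$ on $S$ there is associated a non-empty set $\operatorname{center}(S,d_S)\subset S$ of optimal centers of $S$, whose elements are called centers of $S$; (2) for every metric $d$ on $X$ there exists an optimal clustering $C_1,\dots,C_k$ of $X$ such that for every two distinct clusters $C_i,C_j$, every $p\in C_i$, and all $c_i\in\operatorname{center}(C_i,d|_{C_i})$, $c_j\in\operatorname{center}(C_j,d|_{C_j})$, we have $d(p,c_i)\le d(p,c_j)$; furthermore, if the optimal clustering is unique, then $d(p,c_i)<d(p,c_j)$. The objective is separable if, additionally, there are individual cluster scores $H(C,d|_C)$, each depending only on $C$ and $d|_C$ and computable in polynomial time, such that the cost of a clustering is either the sum of the cluster scores (separable sum-objective) or the maximum of the cluster scores (separable max-objective). Natural center-based objectives. $\mathcal{H}$ is a natural center-based objective for $X$ if there exist polynomial-time computable functions $f$ on $X$ (real-valued) and $g_u(r)$ ($u\in X$, real-valued, non-decreasing in $r$ for every $u$) such that $\mathcal{H}(C_1,\dots,C_k;d)$ equals either $\min_{c_i\in C_i}\sum_{i=1}^k\big(f_{c_i}+\sum_{u\in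 C_i}g_u(d(u,c_i))\big)$ or $\min_{c_i\in C_i}\max\big(\max_i f_{c_i},\ \max_{i,\,u\in C_i}g_u(d(u,c_i))\big)$. Labeled metric spaces. A metric space labeled with a set of labels $L$ ($L$ may be infinite) is a pair $((X,d),l)$, where $(X,d)$ is a metric space and $l:X\to L$ is a function. Two metric spaces $((X',d'),l')$ and $((X'',d''),l'')$ labeled with $L$ are isomorphic if there is a bijection $\varphi:X'\to X''$ with $d'(u,v)=d''(\varphi(u),\varphi(v))$ and $l'(u)=l''(\varphi(u))$ for all $u,v\in X'$. The cost of a clustering may depend on the distances between points and on the point labels, but not on the identities of points. Lloyd's improvement. For a clustering problem $((X,d),\mathcal{H},k)$ with a center-based objective, a clustering $C'_1,\dots,C'_k$ of $X$ is a Lloyd's improvement of a clustering $C_1,\dots,C_k$ of $X$ if there exist centers $c_i\in\operatorname{center}(C_i,d|_{C_i})$, $i=1,\dots,k$, such that $c_i\in C'_i$ for every $i$, and for every $x\in X$: if $x\in C_i$ and $x\in C'_j$, then $d(x,c_j)\le d(x,c_i)$. Universal objectives. $\mathcal{H}$ is a universal center-based clustering objective for a label set $L$ if for every (finite) metric space $((X,d),l)$ labeled with $L$ and every integer $k>1$, the problem $((X,d),\mathcal{H}_l,k)$ is a clustering problem with a separable center-based objective (with cluster scores denoted $H_l$), and the following two conditions hold. (1) Cluster scores are universal: given any finite metric space $((C,d),l)$ labeled with $L$, the function $H_l(C,d)$ returns a real number, the cost of $C$; and $H_{l'}(C',d')=H_{l''}(C'',d'')$ for any two isomorphic labeled metric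 spaces $((C',d'),l')$ and $((C'',d''),l'')$. (2) If $C'_1,\dots,C'_k$ is a Lloyd's improvement of $C_1,\dots,C_k$, then $\mathcal{H}(C'_1,\dots,C'_k;d)\le\mathcal{H}(C_1,\dots,C_k;d)$. For a labeled space $((X,d),l)$, $\mathcal{H}$ denotes $\mathcal{H}_l$. A universal objective is a sum-objective (resp. max-objective) if the cost of a clustering is the sum (resp. maximum) of the scores $H_l(C_i,d|_{C_i})$. -}

module Defs where

open import Level using (0ℓ)
open import Algebra.Structures using (IsCommutativeRing)
open import Data.Bool using (if_then_else_)
open import Data.Fin using (Fin; zero; suc)
open import Data.List using (List; []; _∷_; map; foldr; length; concatMap; allFin)
open import Data.List.Membership.Propositional using (_∈_; _∉_)
open import Data.List.Relation.Binary.Subset.Propositional using (_⊆_)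
open import Data.List.Relation.Unary.All using ([])
open import Data.List.Relation.Unary.AllPairs using ([]; _∷_)
open import Data.List.Relation.Unary.Any using (here)
open import Data.List.Relation.Unary.Unique.Propositional using (Unique)
open import Data.Nat using (ℕ; zero; suc)
import Data.Nat as ℕ
open import Data.Product using (Σ; Σ-syntax; ∃; ∃-syntax; _×_; _,_; proj₁; proj₂)
open import Data.Sum using (_⊎_)
open import Function using (_∘_; _⇔_)
open import Relation.Binary.Bundles using (DecTotalOrder)
open import Relation.Binary.Structures using (IsDecTotalOrder)
open import Relation.Binary.PropositionalEquality using (_≡_; _≢_; refl)
open import Relation.Nullary using (¬_; does)

-- The (classical) real numbers, given by their usual axioms: a Dedekind
-- complete totally ordered field.

record RealNumbers : Set₁ where
  infix  4 _≈_ _≤_ _<_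
  infixl 6 _+_
  infixl 7 _*_
  infix  8 -_
  field
    Carrier           : Set
    _≈_ _≤_           : Carrier → Carrier → Set
    _+_ _*_           : Carrier → Carrier → Carrier
    -_                : Carrier → Carrier
    0# 1#             : Carrier
    isCommutativeRing : IsCommutativeRing _≈_ _+_ _*_ -_ 0# 1#
    isDecTotalOrder   : IsDecTotalOrder _≈_ _≤_
    0≉1               : ¬ (0# ≈ 1#)
    inverse           : ∀ x → ¬ (x ≈ 0#) → ∃[ y ] x * y ≈ 1#
    +-monoˡ-≤         : ∀ z {x y} → x ≤ y → x + z ≤ y + z
    *-nonNegative     : ∀ {x y} → 0# ≤ x → 0# ≤ y → 0# ≤ x * y
    supremum          : (P : Carrier → Set) → ∃ P →
                        (∃[ b ] (∀ x → P x → x ≤ b)) →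
                        ∃[ s ] ((∀ x → P x → x ≤ s) ×
                                (∀ b → (∀ x → P x → x ≤ b) → s ≤ b))

  _<_ : Carrier → Carrier → Set
  x < y = (x ≤ y) × ¬ (x ≈ y)

  decTotalOrder : DecTotalOrder 0ℓ 0ℓ 0ℓ
  decTotalOrder = record { isDecTotalOrder = isDecTotalOrder }

  open IsDecTotalOrder isDecTotalOrder public using (_≤?_)

-- The points of metric spaces are drawn from a fixed type that, like the
-- universe of sets, is not exhausted by any finite set.

Inexhaustible : Set → Set
Inexhaustible Point = (ps : List Point) → ∃[ p ] p ∉ ps

module CenterBasedClustering (𝓡 : RealNumbers) (Point L : Set) where

  open RealNumbers 𝓡 public renaming (Carrier to ℝ)
  open import Data.List.Extrema (DecTotalOrder.totalOrder decTotalOrder) public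
    using (max)

  ∑ : {A : Set} → List A → (A → ℝ) → ℝ
  ∑ as φ = foldr _+_ 0# (map φ as)

  -- The second argument only serves to make the index set non-empty.
  maxFin : ∀ {k} → 1 ℕ.< k → (Fin k → ℝ) → ℝ
  maxFin {suc k} _ φ = max (φ zero) (map φ (allFin (suc k)))

  -- v = min { φ a | a satisfies Q }
  IsMinimum : {A : Set} → (A → Set) → (A → ℝ) → ℝ → Set
  IsMinimum Q φ v = (∃[ a ] Q a × v ≈ φ a) × (∀ a → Q a → v ≤ φ a)

  -- Monotonicity of a function on [0,∞).
  NonDecreasing : (ℝ → ℝ) → Set
  NonDecreasing γ = ∀ {r s} → 0# ≤ r → r ≤ s → γ r ≤ γ s

  ----------------------------------------------------------------------
  -- Finite labeled metric spaces

  record IsMetric (S : List Point) (d : Point → Point → ℝ) : Set where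
    field
      nonNegative : ∀ {x y} → x ∈ S → y ∈ S → 0# ≤ d x y
      separated   : ∀ {x y} → x ∈ S → y ∈ S → (d x y ≈ 0#) ⇔ (x ≡ y)
      symmetric   : ∀ {x y} → x ∈ S → y ∈ S → d x y ≈ d y x
      triangle    : ∀ {x y z} → x ∈ S → y ∈ S → z ∈ S →
                    d x z ≤ d x y + d y z

  -- A finite set is a duplicate-free list.  The values of `dist` and
  -- `label` outside `pts`, as well as the order of `pts`, carry no
  -- information: see `_≐_` and `_≅_`.
  record Space : Set where
    constructor mkSpace
    field
      pts      : List Point
      unique   : Unique pts
      dist     : Point → Point → ℝ
      label    : Point → L
      isMetric : IsMetric pts dist
  open Space public

  -- Equality of labeled metric spaces: the same points, metric and labels.
  record _≐_ (S T : Space) : Set where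
    field
      pts⊆  : pts S ⊆ pts T
      pts⊇  : pts T ⊆ pts S
      dist≈ : ∀ {x y} → x ∈ pts S → y ∈ pts S → dist S x y ≈ dist T x y
      label≡ : ∀ {x} → x ∈ pts S → label S x ≡ label T x

  -- Isomorphism of labeled metric spaces.
  record _≅_ (S T : Space) : Set where
    field
      φ          : Point → Point
      φ∈         : ∀ {x} → x ∈ pts S → φ x ∈ pts T
      injective  : ∀ {x y} → x ∈ pts S → y ∈ pts S → φ x ≡ φ y → x ≡ y
      surjective : ∀ {y} → y ∈ pts T → ∃[ x ] (x ∈ pts S) × (φ x ≡ y)
      dist≈      : ∀ {x y} → x ∈ pts S → y ∈ pts S →
                   dist S x y ≈ dist T (φ x) (φ y)
      label≡     : ∀ {x} → x ∈ pts S → label S x ≡ label T (φ x)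

  restrictMetric : ∀ {S C d} → C ⊆ S → IsMetric S d → IsMetric C d
  restrictMetric C⊆S m = record
    { nonNegative = λ x y → nonNegative (C⊆S x) (C⊆S y)
    ; separated   = λ x y → separated (C⊆S x) (C⊆S y)
    ; symmetric   = λ x y → symmetric (C⊆S x) (C⊆S y)
    ; triangle    = λ x y z → triangle (C⊆S x) (C⊆S y) (C⊆S z)
    } where open IsMetric m

  subspace : (X : Space) (C : List Point) → Unique C → C ⊆ pts X → Space
  subspace X C u C⊆X =
    mkSpace C u (dist X) (label X) (restrictMetric C⊆X (isMetric X))

  singleton : (X : Space) (x : Point) → x ∈ pts X → Space
  singleton X x x∈X =
    subspace X (x ∷ []) ([] ∷ []) (λ { (here refl) → x∈X })

  withMetric : (X : Space) (d : Point → Point → ℝ) → IsMetric (pts X) d → Space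
  withMetric X d m = mkSpace (pts X) (unique X) d (label X) m

  ----------------------------------------------------------------------
  -- Clusterings

  record Clustering (X : List Point) (k : ℕ) : Set where
    field
      cluster  : Fin k → List Point
      unique   : ∀ i → Unique (cluster i)
      nonEmpty : ∀ i → cluster i ≢ []
      within   : ∀ i → cluster i ⊆ X
      covers   : ∀ {x} → x ∈ X → ∃[ i ] x ∈ cluster i
      disjoint : ∀ {x i j} → x ∈ cluster i → x ∈ cluster j → i ≡ j
  open Clustering public using (cluster)

  clusterSpace : (X : Space) {k : ℕ} → Clustering (pts X) k → Fin k → Space
  clusterSpace X C i =
    subspace X (cluster C i) (Clustering.unique C i) (Clustering.within C i)

  -- Equality as unordered partitions (both have k non-empty parts).
  SamePartition : ∀ {X k} → Clustering X k → Clustering X k → Set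
  SamePartition C C′ =
    ∀ i → ∃[ j ] (cluster C i ⊆ cluster C′ j) × (cluster C′ j ⊆ cluster C i)

  -- The objective 𝓗, its centers and its cluster scores.
  Cost Score : Set
  Center : Set₁
  Cost   = (X : Space) {k : ℕ} → Clustering (pts X) k → ℝ
  Center = Space → Point → Set
  Score  = Space → ℝ

  IsOptimal : Cost → (X : Space) {k : ℕ} → Clustering (pts X) k → Set
  IsOptimal cost X {k} C = (C′ : Clustering (pts X) k) → cost X C ≤ cost X C′

  IsUniqueOptimal : Cost → (X : Space) {k : ℕ} → Clustering (pts X) k → Set
  IsUniqueOptimal cost X {k} C =
    IsOptimal cost X C ×
    ((C′ : Clustering (pts X) k) → IsOptimal cost X C′ → SamePartition C C′)

  record IsCenterAssignment (center : Center) : Set where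
    field
      respects-≐ : ∀ {S T} → S ≐ T → ∀ {c} → center S c → center T c
      inside     : ∀ {S c} → center S c → c ∈ pts S
      nonEmpty   : ∀ {S} → pts S ≢ [] → ∃[ c ] center S c

  -- Condition on optimal clusterings in the definition of a center-based
  -- objective on the points (and labels) of X, for all metrics on X.
  CenterBased : Cost → Center → Space → ℕ → Set
  CenterBased cost center X k =
    (d : Point → Point → ℝ) (m : IsMetric (pts X) d) →
    let Xᵈ = withMetric X d m in
    Σ[ C ∈ Clustering (pts X) k ]
      IsOptimal cost Xᵈ C ×
      (∀ {i j} → i ≢ j → ∀ {p cᵢ cⱼ} → p ∈ cluster C i →
       center (clusterSpace Xᵈ C i) cᵢ → center (clusterSpace Xᵈ C j) cⱼ →
       (d p cᵢ ≤ d p cⱼ) ×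
       (IsUniqueOptimal cost Xᵈ C → d p cᵢ < d p cⱼ))

  SeparableSum : Cost → Score → Space → ℕ → Set
  SeparableSum cost score X k =
    (d : Point → Point → ℝ) (m : IsMetric (pts X) d) →
    let Xᵈ = withMetric X d m in
    (C : Clustering (pts X) k) →
    cost Xᵈ C ≈ ∑ (allFin k) (λ i → score (clusterSpace Xᵈ C i))

  SeparableMax : Cost → Score → Space → (k : ℕ) → 1 ℕ.< k → Set
  SeparableMax cost score X k 1<k =
    (d : Point → Point → ℝ) (m : IsMetric (pts X) d) →
    let Xᵈ = withMetric X d m in
    (C : Clustering (pts X) k) →
    cost Xᵈ C ≈ maxFin 1<k (λ i → score (clusterSpace Xᵈ C i))

  -- C′ is a Lloyd's improvement of C.
  LloydImprovement : Center → (X : Space) {k : ℕ} → (C′ C : Clustering (pts X) k) → Set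
  LloydImprovement center X {k} C′ C =
    Σ[ c ∈ (Fin k → Point) ]
      (∀ i → center (clusterSpace X C i) (c i)) ×
      (∀ i → c i ∈ cluster C′ i) ×
      (∀ {x i j} → x ∈ cluster C i → x ∈ cluster C′ j →
       dist X x (c j) ≤ dist X x (c i))

  ----------------------------------------------------------------------
  -- Polynomial-time computability

  data Ty : Set where
    real lbl : Ty
    _⊗_        : Ty → Ty → Ty
    list       : Ty → Ty

  ⟦_⟧ : Ty → Set
  ⟦ real ⟧   = ℝ
  ⟦ lbl ⟧    = L
  ⟦ A ⊗ B ⟧  = ⟦ A ⟧ × ⟦ B ⟧
  ⟦ list A ⟧ = List ⟦ A ⟧

  -- No machine model for real inputs is fixed.  A notion of polynomial-time
  -- computability is any class of functions on these data that is closed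
  -- under composition and contains the basic tuple, list and arithmetic
  -- operations and branching on comparisons.
  record PolynomialTime : Set₁ where
    field
      Poly : ∀ {A B} → (⟦ A ⟧ → ⟦ B ⟧) → Set
      ext  : ∀ {A B} {φ ψ : ⟦ A ⟧ → ⟦ B ⟧} → (∀ a → φ a ≡ ψ a) →
             Poly {A} {B} φ → Poly {A} {B} ψ
      id   : ∀ {A} → Poly {A} {A} (λ a → a)
      comp : ∀ {A B C} {φ : ⟦ B ⟧ → ⟦ C ⟧} {ψ : ⟦ A ⟧ → ⟦ B ⟧} →
             Poly {B} {C} φ → Poly {A} {B} ψ → Poly {A} {C} (φ ∘ ψ)
      pair : ∀ {A B C} {φ : ⟦ A ⟧ → ⟦ B ⟧} {ψ : ⟦ A ⟧ → ⟦ C ⟧} →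
             Poly {A} {B} φ → Poly {A} {C} ψ →
             Poly {A} {B ⊗ C} (λ a → φ a , ψ a)
      fst  : ∀ {A B} → Poly {A ⊗ B} {A} proj₁
      snd  : ∀ {A B} → Poly {A ⊗ B} {B} proj₂
      nil  : ∀ {A B} → Poly {A} {list B} (λ _ → [])
      cons : ∀ {A} → Poly {A ⊗ list A} {list A} (λ (a , as) → a ∷ as)
      zero# : ∀ {A} → Poly {A} {real} (λ _ → 0#)
      add  : Poly {real ⊗ real} {real} (λ (r , s) → r + s)
      neg  : Poly {real} {real} (λ r → - r)
      branch : ∀ {A B} {ρ σ : ⟦ A ⟧ → ℝ} {φ ψ : ⟦ A ⟧ → ⟦ B ⟧} →
               Poly {A} {real} ρ → Poly {A} {real} σ →
               Poly {A} {B} φ → Poly {A} {B} ψ →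
               Poly {A} {B} (λ a → if does (ρ a ≤? σ a) then φ a else ψ a)

  -- A space is presented to an algorithm by the labels of its points and
  -- its distance matrix.
  encode : Space → ⟦ list lbl ⊗ list (list real) ⟧
  encode S = map (label S) (pts S) ,
             map (λ x → map (dist S x) (pts S)) (pts S)

  module _ (𝓟 : PolynomialTime) where

    open PolynomialTime 𝓟 using (Poly)

    PolyScore : Score → Set
    PolyScore score =
      Σ[ alg ∈ (⟦ list lbl ⊗ list (list real) ⟧ → ℝ) ]
        Poly {list lbl ⊗ list (list real)} {real} alg ×
        (∀ S → pts S ≢ [] → score S ≈ alg (encode S))

    -- Algorithms for f and g access a point u of X through its label.
    PolyWeights : Space → (Point → ℝ) → Set
    PolyWeights X f =
      Σ[ F ∈ (L → ℝ) ] Poly {lbl} {real} F ×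
        (∀ {u} → u ∈ pts X → f u ≈ F (label X u))

    PolyRadial : Space → (Point → ℝ → ℝ) → Set
    PolyRadial X g =
      Σ[ G ∈ (L × ℝ → ℝ) ] Poly {lbl ⊗ real} {real} G ×
        (∀ {u} → u ∈ pts X → ∀ {r} → 0# ≤ r → g u r ≈ G (label X u , r))

    --------------------------------------------------------------------
    -- Natural center-based objectives

    NaturalSum : Cost → Space → ℕ → (Point → ℝ) → (Point → ℝ → ℝ) → Set
    NaturalSum cost X k f g =
      (d : Point → Point → ℝ) (m : IsMetric (pts X) d)
      (C : Clustering (pts X) k) →
      IsMinimum {Fin k → Point} (λ c → ∀ i → c i ∈ cluster C i)
        (λ c → ∑ (allFin k) λ i → f (c i) + ∑ (cluster C i) λ u → g u (d u (c i)))
        (cost (withMetric X d m) C)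

    NaturalMax : Cost → Space → (k : ℕ) → 1 ℕ.< k →
                 (Point → ℝ) → (Point → ℝ → ℝ) → Set
    NaturalMax cost X k 1<k f g =
      (d : Point → Point → ℝ) (m : IsMetric (pts X) d)
      (C : Clustering (pts X) k) →
      IsMinimum {Fin k → Point} (λ c → ∀ i → c i ∈ cluster C i)
        (λ c → max (maxFin 1<k (λ i → f (c i)))
                   (concatMap (λ i → map (λ u → g u (d u (c i))) (cluster C i))
                              (allFin k)))
        (cost (withMetric X d m) C)

    IsNatural : Cost → Space → (k : ℕ) → 1 ℕ.< k → Set
    IsNatural cost X k 1<k =
      Σ[ f ∈ (Point → ℝ) ] Σ[ g ∈ (Point → ℝ → ℝ) ]
        PolyWeights X f × PolyRadial X g ×
        (∀ {u} → u ∈ pts X → NonDecreasing (g u)) ×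
        (NaturalSum cost X k f g ⊎ NaturalMax cost X k 1<k f g)

    --------------------------------------------------------------------
    -- Universal objectives

    -- `center` depends on the labeled metric space S alone, not on a space
    -- containing S or on k.  A partition into k non-empty parts exists only
    -- if k ≤ |X|, so only then can an optimal one be required.
    record UniversalObjective : Set₁ where
      field
        cost               : Cost
        center             : Center
        score              : Score
        cost-nonNegative   : ∀ X {k} → 1 ℕ.< k → (C : Clustering (pts X) k) →
                             0# ≤ cost X C
        isCenterAssignment : IsCenterAssignment center
        centerBased        : ∀ X k → 1 ℕ.< k → k ℕ.≤ length (pts X) →
                             CenterBased cost center X k
        separable          : ∀ X k (1<k : 1 ℕ.< k) →
                             SeparableSum cost score X k ⊎
                             SeparableMax cost score X k 1<k
        score-poly         : PolyScore score
        score-≅            : ∀ {S T} → pts S ≢ [] → S ≅ T → score S ≈ score T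
        lloyd              : ∀ X {k} → 1 ℕ.< k → (C′ C : Clustering (pts X) k) →
                             LloydImprovement center X C′ C →
                             cost X C′ ≤ cost X C

      IsSumObjective : Set
      IsSumObjective = ∀ X k → 1 ℕ.< k → SeparableSum cost score X k

      IsMaxObjective : Set
      IsMaxObjective = ∀ X k (1<k : 1 ℕ.< k) → SeparableMax cost score X k 1<k

    -- `value C d c` is the expression to be minimized over c ∈ C.
    Represents : UniversalObjective → Space →
                 (List Point → (Point → Point → ℝ) → Point → ℝ) → Set
    Represents H X value =
      (C : List Point) (u : Unique C) → C ≢ [] → C ⊆ pts X →
      (d : Point → Point → ℝ) (m : IsMetric C d) →
      let S = mkSpace C u d (label X) m in
      IsMinimum (_∈ C) (value C d) (score S) ×
      (∀ {c} → center S c → score S ≈ value C d c)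
      where open UniversalObjective H using (center; score)

module Submission where

-- Let σ(l) be the score of a singleton labeled l, and π(l,r) that of two points
-- labeled l at distance r > 0.  Attach to every point x of a cluster C a twin x′
-- with the same label, at distance d(x,c) from x, and compare two clusterings:
-- C with all {x′} as singletons, and {c} with all the pairs {x,x′}.  Moving each
-- x ≠ c from c to x′ does not change its distance to its center, so this is a
-- Lloyd's improvement if c is a center of C; in the other direction it is one if
-- each x′ is a center of its pair, which the symmetry of the pair permits to
-- assume.  For a sum-objective, subtracting the singletons gives
--   H(C) ≤ σ(c) + Σ_{x ≠ c} (π(x,d(x,c)) − σ(x)),
-- with equality if c is a center, i.e. f = σ and g = π − σ; for a max-objective
-- whose singletons cost 0 it gives f = 0 and g = π.  Shorter distances to the
-- twins make g monotone.

open import Defs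
open import Algebra.Bundles using (CommutativeRing)
import Algebra.Properties.CommutativeSemigroup as CommutativeSemigroupProperties
import Algebra.Properties.Ring as RingProperties
open import Data.Bool using (Bool; true; false; if_then_else_)
open import Data.Bool.Properties using () renaming (_≟_ to _≟ᵇ_)
open import Data.Empty using (⊥-elim)
open import Data.Fin using (Fin; zero; suc)
open import Data.Fin.Properties using () renaming (_≟_ to _≟ᶠ_)
open import Data.List using (List; []; _∷_; map; foldr; filter; lookup; length; allFin; tabulate; concatMap; cartesianProduct)
import Data.List.Extrema as Extrema
import Data.List.Membership.DecPropositional as DecMembership
open import Data.List.Membership.Propositional using (_∈_; _∉_; find; lose)
open import Data.List.Membership.Propositional.Properties using
  ( ∈-map⁺; ∈-map⁻; ∈-filter⁺; ∈-filter⁻; ∈-lookup; ∈-allFin; ∈-cartesianProduct⁺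
  ; ∈-tabulate⁺; ∈-tabulate⁻; ∈-concatMap⁺; ∈-concatMap⁻ )
open import Data.List.Properties using (map-tabulate; tabulate-lookup)
open import Data.List.Relation.Binary.Subset.Propositional using (_⊆_)
open import Data.List.Relation.Unary.All as All using ([]; _∷_)
open import Data.List.Relation.Unary.AllPairs using ([]; _∷_)
open import Data.List.Relation.Unary.Any using (here; there; any?; index)
open import Data.List.Relation.Unary.Any.Properties using (lookup-index)
open import Data.List.Relation.Unary.Unique.Propositional using (Unique)
import Data.List.Relation.Unary.Unique.Propositional.Properties as Uniqueₚ
open import Data.Nat using (ℕ; suc)
import Data.Nat as ℕ
open import Data.Product using (Σ-syntax; ∃; ∃-syntax; _×_; _,_; proj₁; proj₂; uncurry)
open import Data.Product.Properties using (≡-dec)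
open import Data.Sum using (inj₁; inj₂; [_,_])
open import Data.Unit using (⊤; tt)
open import Data.Vec.Functional using () renaming (_∷_ to _∷ᶠ_)
open import Function using (_∘_; id; case_of_; mk⇔; Equivalence)
open import Level using (0ℓ)
open import Relation.Binary.Bundles using (DecTotalOrder)
open import Relation.Binary.Definitions using (DecidableEquality)
open import Relation.Binary.PropositionalEquality as ≡ using (_≡_; _≢_; refl)
open import Relation.Nullary using (¬_; Dec; yes; no; does)

-- Scores are invariant under isomorphism, whereas centers are only known to respect equality of
-- labeled spaces. Hence a center of C can be used only at the very points of C, which therefore
-- keep their names beside fresh twins; and the center of a pair has to be found before its two
-- points are named, so that the other comparison takes place on a fresh copy of C, linked to C by
-- its score alone. The second obstacle is distance 0. The point c must contribute nothing to its
-- own cluster, so g vanishes at 0, and monotonicity then also demands that g be nonnegative at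
-- positive distances. Only costs, not scores, are given to be nonnegative; placing two copies of a
-- cluster side by side transfers this to scores. For a max-objective that settles the matter, as g
-- is itself the score of a pair; for a sum-objective g is a difference of scores, and its sign
-- comes from completeness, through the Archimedean property.

-- Ordered-field arithmetic and pseudometrics.

module OrderedField (𝓡 : RealNumbers) where

  open RealNumbers 𝓡 renaming (Carrier to ℝ)

  commutativeRing : CommutativeRing 0ℓ 0ℓ
  commutativeRing = record { isCommutativeRing = isCommutativeRing }

  open CommutativeRing commutativeRing public
    using ( +-cong; +-congˡ; +-comm; +-assoc; +-identityˡ; +-identityʳ
          ; -‿inverseˡ; -‿inverseʳ; -‿cong; +-commutativeSemigroup )
  open CommutativeSemigroupProperties +-commutativeSemigroup public
    using (interchange)
  open DecTotalOrder decTotalOrder public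
    using (poset; totalOrder; antisym; total; module Eq)
    renaming (refl to ≤-refl; reflexive to ≤-reflexive; trans to ≤-trans)

  open import Relation.Binary.Reasoning.PartialOrder poset public

  open RingProperties (CommutativeRing.ring commutativeRing) public using (-‿+-comm)

  Positive : ℝ → Set
  Positive r = ¬ (r ≤ 0#)

  positive⇒0≤ : ∀ {r} → Positive r → 0# ≤ r
  positive⇒0≤ {r} r>0 = [ (λ r≤0 → ⊥-elim (r>0 r≤0)) , (λ 0≤r → 0≤r) ] (total r 0#)

  +-mono-≤ : ∀ {a b c d} → a ≤ b → c ≤ d → a + c ≤ b + d
  +-mono-≤ {a} {b} {c} {d} a≤b c≤d = begin
    a + c ≤⟨ +-monoˡ-≤ c a≤b ⟩
    b + c ≈⟨ +-comm b c ⟩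
    c + b ≤⟨ +-monoˡ-≤ b c≤d ⟩
    d + b ≈⟨ +-comm d b ⟩
    b + d ∎

  +-inverseʳ-cancel : ∀ a c → (a + c) + - c ≈ a
  +-inverseʳ-cancel a c =
    Eq.trans (+-assoc a c (- c)) (Eq.trans (+-congˡ (-‿inverseʳ c)) (+-identityʳ a))

  +-inverseˡ-cancel : ∀ a c → a + (c + - a) ≈ c
  +-inverseˡ-cancel a c = Eq.trans (+-comm a (c + - a))
    (Eq.trans (+-assoc c (- a) a) (Eq.trans (+-congˡ (-‿inverseˡ a)) (+-identityʳ c)))

  +-cancelʳ-≤ : ∀ {a b} c → a + c ≤ b + c → a ≤ b
  +-cancelʳ-≤ {a} {b} c a+c≤b+c = begin
    a             ≈⟨ +-inverseʳ-cancel a c ⟨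
    (a + c) + - c ≤⟨ +-monoˡ-≤ (- c) a+c≤b+c ⟩
    (b + c) + - c ≈⟨ +-inverseʳ-cancel b c ⟩
    b             ∎

  0≤-+ : ∀ {a b} → 0# ≤ a → 0# ≤ b → 0# ≤ a + b
  0≤-+ 0≤a 0≤b = ≤-trans (≤-reflexive (Eq.sym (+-identityˡ 0#))) (+-mono-≤ 0≤a 0≤b)

  a≤a+b : ∀ {a b} → 0# ≤ b → a ≤ a + b
  a≤a+b {a} 0≤b = ≤-trans (≤-reflexive (Eq.sym (+-identityʳ a))) (+-mono-≤ ≤-refl 0≤b)

  a≤b+a : ∀ {a b} → 0# ≤ b → a ≤ b + a
  a≤b+a {a} {b} 0≤b = ≤-trans (a≤a+b 0≤b) (≤-reflexive (+-comm a b))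

  0≤a+a⇒0≤a : ∀ {a} → 0# ≤ a + a → 0# ≤ a
  0≤a+a⇒0≤a {a} 0≤2a with total 0# a
  ... | inj₁ 0≤a = 0≤a
  ... | inj₂ a≤0 = begin
    0#     ≤⟨ 0≤2a ⟩
    a + a  ≤⟨ +-mono-≤ a≤0 ≤-refl ⟩
    0# + a ≈⟨ +-identityˡ a ⟩
    a      ∎

  a+b≈0⇒a≈0 : ∀ {a b} → 0# ≤ a → 0# ≤ b → a + b ≈ 0# → a ≈ 0#
  a+b≈0⇒a≈0 0≤a 0≤b a+b≈0 = antisym (≤-trans (a≤a+b 0≤b) (≤-reflexive a+b≈0)) 0≤a

  0≤b+a⇒-a≤b : ∀ {a b} → 0# ≤ b + a → - a ≤ b
  0≤b+a⇒-a≤b {a} {b} 0≤b+a = +-cancelʳ-≤ a (≤-trans (≤-reflexive (-‿inverseˡ a)) 0≤b+a)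

  -a≤0⇒0≤a : ∀ {a} → - a ≤ 0# → 0# ≤ a
  -a≤0⇒0≤a {a} -a≤0 = begin
    0#       ≈⟨ -‿inverseˡ a ⟨
    - a + a  ≤⟨ +-monoˡ-≤ a -a≤0 ⟩
    0# + a   ≈⟨ +-identityˡ a ⟩
    a        ∎

  ∃-positive : ∃ Positive
  ∃-positive with total 0# 1#
  ... | inj₁ 0≤1 = 1# , λ 1≤0 → 0≉1 (antisym 0≤1 1≤0)
  ... | inj₂ 1≤0 = - 1# , λ -1≤0 → 0≉1 (antisym (-a≤0⇒0≤a -1≤0) 1≤0)

  -- Let t be the supremum of the terms. Each `s m` is at most t - a, because the next term is at
  -- most t; so t - a is an upper bound too, and t ≤ t - a.
  archimedean : ∀ {a b} (s : ℕ → ℝ) → (∀ m → s m + a ≤ s (suc m)) →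
                (∀ m → s m ≤ b) → a ≤ 0#
  archimedean {a} {b} s step bounded
    with t , upper , least ← supremum (λ x → ∃ λ m → x ≡ s m) (s 0 , 0 , refl)
                               (b , λ { _ (m , refl) → bounded m }) =
    +-cancelʳ-≤ t (begin
      a + t           ≤⟨ +-mono-≤ ≤-refl (least (t + - a) λ { _ (m , refl) → s≤t-a m }) ⟩
      a + (t + - a)   ≈⟨ +-inverseˡ-cancel a t ⟩
      t               ≈⟨ +-identityˡ t ⟨
      0# + t          ∎)
    where
    s≤t-a : ∀ m → s m ≤ t + - a
    s≤t-a m = +-cancelʳ-≤ a (begin
      s m + a         ≤⟨ step m ⟩
      s (suc m)       ≤⟨ upper _ (suc m , refl) ⟩
      t               ≈⟨ +-inverseˡ-cancel a t ⟨
      a + (t + - a)   ≈⟨ +-comm a (t + - a) ⟩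
      (t + - a) + a   ∎)

  record IsPseudometric {T : Set} (ε : T → T → ℝ) : Set where
    field
      nonNegative : ∀ s t → 0# ≤ ε s t
      self        : ∀ t → ε t t ≈ 0#
      symmetric   : ∀ s t → ε s t ≈ ε t s
      triangle    : ∀ s t u → ε s u ≤ ε s t + ε t u

  module Discrete {T : Set} (_≟_ : DecidableEquality T) (w : T → T → ℝ) where

    -- Overriding the diagonal allows a `w` that does not vanish there: a constant, for points at
    -- mutual distance r, or a sum of two heights, for pendant edges.
    discrete : T → T → ℝ
    discrete s t = if does (s ≟ t) then 0# else w s t

    discrete-self : ∀ t → discrete t t ≡ 0#
    discrete-self t with t ≟ t
    ... | yes _   = refl
    ... | no  t≢t = ⊥-elim (t≢t refl)

    discrete-≢ : ∀ {s t} → s ≢ t → discrete s t ≡ w s t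
    discrete-≢ {s} {t} s≢t with s ≟ t
    ... | yes s≡t = ⊥-elim (s≢t s≡t)
    ... | no  _   = refl

    discrete-≈0 : ∀ {s t} → w s t ≈ 0# → discrete s t ≈ 0#
    discrete-≈0 {s} {t} w≈0 with s ≟ t
    ... | yes _ = Eq.refl
    ... | no  _ = w≈0

    isPseudometric :
      (∀ s t → 0# ≤ w s t) → (∀ s t → w s t ≈ w t s) →
      (∀ s t u → w s u ≤ w s t + w t u) → IsPseudometric discrete
    isPseudometric 0≤w w-sym w-tri = record
      { nonNegative = nonNegative
      ; self        = λ t → Eq.reflexive (discrete-self t)
      ; symmetric   = symmetric
      ; triangle    = triangle
      }
      where
      nonNegative : ∀ s t → 0# ≤ discrete s t
      nonNegative s t with s ≟ t
      ... | yes _ = ≤-refl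
      ... | no  _ = 0≤w s t

      symmetric : ∀ s t → discrete s t ≈ discrete t s
      symmetric s t with s ≟ t | t ≟ s
      ... | yes _   | yes _   = Eq.refl
      ... | no  _   | no  _   = w-sym s t
      ... | yes s≡t | no  t≢s = ⊥-elim (t≢s (≡.sym s≡t))
      ... | no  s≢t | yes t≡s = ⊥-elim (s≢t (≡.sym t≡s))

      triangle : ∀ s t u → discrete s u ≤ discrete s t + discrete t u
      triangle s t u with s ≟ u
      ... | yes _ = 0≤-+ (nonNegative s t) (nonNegative t u)
      ... | no s≢u with s ≟ t | t ≟ u
      ...   | yes refl | yes refl = ⊥-elim (s≢u refl)
      ...   | yes refl | no  _    = a≤b+a ≤-refl
      ...   | no  _    | yes refl = a≤a+b ≤-refl
      ...   | no  _    | no  _    = w-tri s t u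

-- Fresh points and enumerations of finite sets.

lookup-injective : {A : Set} {xs : List A} → Unique xs →
                   ∀ {i j} → lookup xs i ≡ lookup xs j → i ≡ j
lookup-injective (_    ∷ _)  {zero}  {zero}  _  = refl
lookup-injective (x∉xs ∷ _)  {zero}  {suc j} eq = ⊥-elim (All.lookup x∉xs (∈-lookup j) eq)
lookup-injective (x∉xs ∷ _)  {suc i} {zero}  eq = ⊥-elim (All.lookup x∉xs (∈-lookup i) (≡.sym eq))
lookup-injective (_    ∷ xs) {suc i} {suc j} eq = ≡.cong suc (lookup-injective xs eq)

Injective : {A B : Set} → (A → B) → Set
Injective φ = ∀ {a b} → φ a ≡ φ b → a ≡ b

join : {A B : Set} → (A → B) → (A → B) → A × Bool → B
join φ ψ (a , false) = φ a
join φ ψ (a , true)  = ψ a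

join-injective : {A B : Set} {φ ψ : A → B} → Injective φ → Injective ψ →
                 (∀ a b → φ a ≢ ψ b) → Injective (join φ ψ)
join-injective φ-inj ψ-inj φ≢ψ {a , false} {b , false} eq = ≡.cong (_, false) (φ-inj eq)
join-injective φ-inj ψ-inj φ≢ψ {a , false} {b , true}  eq = ⊥-elim (φ≢ψ a b eq)
join-injective φ-inj ψ-inj φ≢ψ {a , true}  {b , false} eq = ⊥-elim (φ≢ψ b a (≡.sym eq))
join-injective φ-inj ψ-inj φ≢ψ {a , true}  {b , true}  eq = ≡.cong (_, true) (ψ-inj eq)

fresh : {A : Set} → Inexhaustible A → ∀ n (ps : List A) →
        ∃[ φ ] Injective {Fin n} φ × (∀ i → φ i ∉ ps)
fresh inexhaustible ℕ.zero ps = (λ ()) , (λ { {()} }) , λ ()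
fresh {A} inexhaustible (suc n) ps
  with p , p∉ps ← inexhaustible ps
  with φ , φ-inj , φ∉ ← fresh inexhaustible n (p ∷ ps) =
    ψ , (λ {i} {j} → ψ-inj i j) , ψ∉
  where
  ψ : Fin (suc n) → A
  ψ zero    = p
  ψ (suc i) = φ i

  ψ-inj : ∀ i j → ψ i ≡ ψ j → i ≡ j
  ψ-inj zero    zero    _  = refl
  ψ-inj zero    (suc j) eq = ⊥-elim (φ∉ j (here (≡.sym eq)))
  ψ-inj (suc i) zero    eq = ⊥-elim (φ∉ i (here eq))
  ψ-inj (suc i) (suc j) eq = ≡.cong suc (φ-inj eq)

  ψ∉ : ∀ i → ψ i ∉ ps
  ψ∉ zero    = p∉ps
  ψ∉ (suc i) = φ∉ i ∘ there

-- Two spaces enumerated by the same index type can be compared index by index, which reduces both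
-- isomorphism and equality to matching distances and labels.
record Enumerates {I A : Set} (x : I → A) (xs : List A) : Set where
  field
    member    : ∀ i → x i ∈ xs
    onto      : ∀ {a} → a ∈ xs → ∃[ i ] x i ≡ a
    injective : Injective x

lookup-enumerates : {A : Set} {xs : List A} → Unique xs → Enumerates (lookup xs) xs
lookup-enumerates {xs = xs} u = record
  { member    = ∈-lookup
  ; onto      = λ a∈ → index a∈ , ≡.sym (lookup-index a∈)
  ; injective = lookup-injective u
  }

pair-enumerates : {A : Set} {p q : A} → p ≢ q →
                  Enumerates (λ b → if b then q else p) (p ∷ q ∷ [])
pair-enumerates p≢q = record
  { member    = λ { false → here refl ; true → there (here refl) }
  ; onto      = λ { (here refl) → false , refl ; (there (here refl)) → true , refl }
  ; injective = λ { {false} {false} _ → refl ; {true} {true} _ → refl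
                  ; {false} {true} eq → ⊥-elim (p≢q eq)
                  ; {true} {false} eq → ⊥-elim (p≢q (≡.sym eq)) }
  }

-- The index `true` will stand for the twin, so this lets any prescribed point of a pair, in
-- particular a center, play the twin.
pair-enumerates-at : {A : Set} {p q c : A} → p ≢ q → c ∈ p ∷ q ∷ [] →
                     Σ[ x ∈ (Bool → A) ] Enumerates x (p ∷ q ∷ []) × x true ≡ c
pair-enumerates-at {p = p} {q} p≢q (there (here refl)) = _ , pair-enumerates p≢q , refl
pair-enumerates-at {p = p} {q} p≢q (here refl) = (λ b → if b then p else q) , record
  { member    = λ { true → here refl ; false → there (here refl) }
  ; onto      = λ { (here refl) → true , refl ; (there (here refl)) → false , refl }
  ; injective = λ { {false} {false} _ → refl ; {true} {true} _ → refl
                  ; {false} {true} eq → ⊥-elim (p≢q (≡.sym eq))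
                  ; {true} {false} eq → ⊥-elim (p≢q eq) }
  } , refl

singleton-enumerates : {A : Set} {p : A} → Enumerates {⊤} (λ _ → p) (p ∷ [])
singleton-enumerates = record
  { member    = λ _ → here refl
  ; onto      = λ { (here refl) → tt , refl }
  ; injective = λ _ → refl
  }

-- Comparison of spaces, uniform spaces, and doubled spaces with their partitions.

module Spaces (𝓡 : RealNumbers) (Point L : Set) (_≟_ : DecidableEquality Point) where

  open CenterBasedClustering 𝓡 Point L
  open OrderedField 𝓡
  open DecMembership _≟_ using (_∈?_)

  module _ {I : Set} (S T : Space) {x y : I → Point}
           (x-enum : Enumerates x (pts S)) (y-enum : Enumerates y (pts T))
           (dist-x≈y : ∀ i j → dist S (x i) (x j) ≈ dist T (y i) (y j))
           (label-x≡y : ∀ i → label S (x i) ≡ label T (y i)) where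

    private
      module X = Enumerates x-enum
      module Y = Enumerates y-enum

    transport : Point → Point
    transport p with p ∈? pts S
    ... | yes p∈S = y (proj₁ (X.onto p∈S))
    ... | no  _   = p

    transport-x : ∀ i → transport (x i) ≡ y i
    transport-x i with x i ∈? pts S
    ... | yes xi∈S = ≡.cong y (X.injective (proj₂ (X.onto xi∈S)))
    ... | no  xi∉S = ⊥-elim (xi∉S (X.member i))

    enumerated-≅ : S ≅ T
    enumerated-≅ = record
      { φ          = transport
      ; φ∈         = φ∈
      ; injective  = injective
      ; surjective = surjective
      ; dist≈      = dist≈
      ; label≡     = label≡
      }
      where
      φ∈ : ∀ {p} → p ∈ pts S → transport p ∈ pts T
      φ∈ p∈ with i , refl ← X.onto p∈ = ≡.subst (_∈ pts T) (≡.sym (transport-x i)) (Y.member i)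

      injective : ∀ {p q} → p ∈ pts S → q ∈ pts S → transport p ≡ transport q → p ≡ q
      injective p∈ q∈ eq with i , refl ← X.onto p∈ | j , refl ← X.onto q∈ =
        ≡.cong x (Y.injective (≡.trans (≡.sym (transport-x i)) (≡.trans eq (transport-x j))))

      surjective : ∀ {q} → q ∈ pts T → ∃[ p ] (p ∈ pts S) × (transport p ≡ q)
      surjective q∈ with i , refl ← Y.onto q∈ = x i , X.member i , transport-x i

      dist≈ : ∀ {p q} → p ∈ pts S → q ∈ pts S →
              dist S p q ≈ dist T (transport p) (transport q)
      dist≈ p∈ q∈ with i , refl ← X.onto p∈ | j , refl ← X.onto q∈
        rewrite transport-x i | transport-x j = dist-x≈y i j

      label≡ : ∀ {p} → p ∈ pts S → label S p ≡ label T (transport p)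
      label≡ p∈ with i , refl ← X.onto p∈ rewrite transport-x i = label-x≡y i

  enumerated-≐ : ∀ {I : Set} (S T : Space) {x : I → Point} →
                 Enumerates x (pts S) → Enumerates x (pts T) →
                 (∀ i j → dist S (x i) (x j) ≈ dist T (x i) (x j)) →
                 (∀ i → label S (x i) ≡ label T (x i)) → S ≐ T
  enumerated-≐ S T {x} x-enum y-enum dist-eq label-eq = record
    { pts⊆   = λ p∈ → let i , eq = X.onto p∈ in ≡.subst (_∈ pts T) eq (Y.member i)
    ; pts⊇   = λ p∈ → let i , eq = Y.onto p∈ in ≡.subst (_∈ pts S) eq (X.member i)
    ; dist≈  = dist≈
    ; label≡ = label≡
    }
    where
    module X = Enumerates x-enum
    module Y = Enumerates y-enum

    dist≈ : ∀ {p q} → p ∈ pts S → q ∈ pts S → dist S p q ≈ dist T p q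
    dist≈ p∈ q∈ with i , refl ← X.onto p∈ | j , refl ← X.onto q∈ = dist-eq i j

    label≡ : ∀ {p} → p ∈ pts S → label S p ≡ label T p
    label≡ p∈ with i , refl ← X.onto p∈ = label-eq i

  dist-self : ∀ S {p} → p ∈ pts S → dist S p p ≈ 0#
  dist-self S p∈ = Equivalence.from (IsMetric.separated (isMetric S) p∈ p∈) refl

  dist-positive : ∀ S {p q} → p ∈ pts S → q ∈ pts S → p ≢ q → Positive (dist S p q)
  dist-positive S p∈ q∈ p≢q d≤0 = p≢q (Equivalence.to (separated p∈ q∈)
    (antisym d≤0 (nonNegative p∈ q∈)))
    where open IsMetric (isMetric S)

  module Uniform (r : ℝ) (r>0 : Positive r) (l : L) where

    open Discrete _≟_ (λ _ _ → r)

    private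
      module P = IsPseudometric (isPseudometric (λ _ _ → positive⇒0≤ r>0)
        (λ _ _ → Eq.refl) (λ _ _ _ → a≤a+b (positive⇒0≤ r>0)))

    uniform : (ps : List Point) → Unique ps → Space
    uniform ps u = mkSpace ps u discrete (λ _ → l) (record
      { nonNegative = λ _ _ → P.nonNegative _ _
      ; separated   = λ _ _ → mk⇔ separated (λ { refl → P.self _ })
      ; symmetric   = λ _ _ → P.symmetric _ _
      ; triangle    = λ _ _ _ → P.triangle _ _ _
      })
      where
      separated : ∀ {p q} → discrete p q ≈ 0# → p ≡ q
      separated {p} {q} d≈0 with p ≟ q
      ... | yes p≡q = p≡q
      ... | no  _   = ⊥-elim (r>0 (≤-reflexive d≈0))

    open Discrete _≟_ (λ _ _ → r) public using () renaming
      (discrete-self to uniform-self; discrete-≢ to uniform-≢)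

  -- Two copies P (i , false) and P (i , true) of each point x i of S, with the
  -- metric of S plus a pseudometric ε that separates the copies.
  module Doubling
    (S : Space) {n : ℕ} {x : Fin n → Point} (x-enum : Enumerates x (pts S))
    (i₀ : Fin n)
    (P : Fin n × Bool → Point) (P-injective : Injective P)
    (ε : Fin n × Bool → Fin n × Bool → ℝ) (ε-pseudo : IsPseudometric ε)
    (ε-separates : ∀ i → ¬ (ε (i , false) (i , true) ≈ 0#)) where

    private
      module X = Enumerates x-enum
      module ε = IsPseudometric ε-pseudo
      module S = IsMetric (isMetric S)

    E : Set
    E = Fin n × Bool

    all : List E
    all = cartesianProduct (allFin n) (false ∷ true ∷ [])

    ∈-all : ∀ e → e ∈ all
    ∈-all (i , false) = ∈-cartesianProduct⁺ (∈-allFin i) (here refl)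
    ∈-all (i , true)  = ∈-cartesianProduct⁺ (∈-allFin i) (there (here refl))

    all-unique : Unique all
    all-unique = Uniqueₚ.cartesianProduct⁺ (Uniqueₚ.allFin⁺ n) (((λ ()) ∷ []) ∷ [] ∷ [])

    -- A left inverse of `P`, through which the metric, a function on all of `Point`, is computed on
    -- indices. Off the image of `P` the value is arbitrary, and `i₀` supplies one.
    idx : Point → E
    idx p with any? (λ e → P e ≟ p) all
    ... | yes p∈ = proj₁ (find p∈)
    ... | no  _  = i₀ , false

    idx-P : ∀ e → idx (P e) ≡ e
    idx-P e with any? (λ e′ → P e′ ≟ P e) all
    ... | yes p∈ = P-injective (proj₂ (proj₂ (find p∈)))
    ... | no  p∉ = ⊥-elim (p∉ (lose (∈-all e) refl))

    base : E → Point
    base (i , _) = x i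

    δ : E → E → ℝ
    δ e e′ = dist S (base e) (base e′) + ε e e′

    base∈ : ∀ e → base e ∈ pts S
    base∈ (i , _) = X.member i

    δ-self : ∀ e → δ e e ≈ 0#
    δ-self e = Eq.trans (+-cong (dist-self S (base∈ e)) (ε.self e)) (+-identityˡ 0#)

    -- Both nonnegative summands vanish: the one from `S` identifies the base points, the one from
    -- `ε` then identifies the copies.
    δ-separated : ∀ e e′ → δ e e′ ≈ 0# → e ≡ e′
    δ-separated e@(i , b) e′@(j , b′) δ≈0
      with refl ← X.injective (Equivalence.to (S.separated (base∈ e) (base∈ e′)) (a+b≈0⇒a≈0
             (S.nonNegative (base∈ e) (base∈ e′)) (ε.nonNegative e e′) δ≈0)) =
      ≡.cong (i ,_) (twins b b′ (a+b≈0⇒a≈0 (ε.nonNegative e e′)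
        (S.nonNegative (base∈ e) (base∈ e′)) (Eq.trans (+-comm _ _) δ≈0)))
      where
      twins : ∀ b b′ → ε (i , b) (i , b′) ≈ 0# → b ≡ b′
      twins false false _   = refl
      twins true  true  _   = refl
      twins false true  ε≈0 = ⊥-elim (ε-separates i ε≈0)
      twins true  false ε≈0 = ⊥-elim (ε-separates i (Eq.trans (ε.symmetric _ _) ε≈0))

    δ-triangle : ∀ e e′ e″ → δ e e″ ≤ δ e e′ + δ e′ e″
    δ-triangle e e′ e″ = ≤-trans
      (+-mono-≤ (S.triangle (base∈ e) (base∈ e′) (base∈ e″)) (ε.triangle e e′ e″))
      (≤-reflexive (interchange _ _ _ _))

    space : Space
    space = mkSpace (map P all) (Uniqueₚ.map⁺ P-injective all-unique)
      (λ p q → δ (idx p) (idx q)) (λ p → label S (base (idx p))) (record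
      { nonNegative = λ {p} {q} _ _ →
          0≤-+ (S.nonNegative (base∈ (idx p)) (base∈ (idx q))) (ε.nonNegative _ _)
      ; separated   = λ p∈ q∈ → mk⇔ (separated p∈ q∈) (λ { refl → δ-self _ })
      ; symmetric   = λ {p} {q} _ _ →
          +-cong (S.symmetric (base∈ (idx p)) (base∈ (idx q))) (ε.symmetric _ _)
      ; triangle    = λ _ _ _ → δ-triangle _ _ _
      })
      where
      separated : ∀ {p q} → p ∈ map P all → q ∈ map P all → δ (idx p) (idx q) ≈ 0# → p ≡ q
      separated p∈ q∈ δ≈0 with e , _ , refl ← ∈-map⁻ P p∈ | e′ , _ , refl ← ∈-map⁻ P q∈ =
        ≡.cong P (δ-separated e e′
          (≡.subst (_≈ 0#) (≡.cong₂ δ (idx-P e) (idx-P e′)) δ≈0))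

    dist-P : ∀ e e′ → dist space (P e) (P e′) ≡ δ e e′
    dist-P e e′ = ≡.cong₂ δ (idx-P e) (idx-P e′)

    label-P : ∀ e → label space (P e) ≡ label S (base e)
    label-P e = ≡.cong (label S ∘ base) (idx-P e)

    module Partition {k : ℕ} (α : E → Fin k) (α-onto : ∀ c → ∃[ e ] α e ≡ c) where

      -- Describing a clustering by the map from indices to cluster numbers makes covering and
      -- disjointness automatic; surjectivity is non-emptiness.
      cell : Fin k → List Point
      cell c = map P (filter (λ e → α e ≟ᶠ c) all)

      ∈-cell⁺ : ∀ {c} e → α e ≡ c → P e ∈ cell c
      ∈-cell⁺ e eq = ∈-map⁺ P (∈-filter⁺ _ (∈-all e) eq)

      ∈-cell⁻ : ∀ {c p} → p ∈ cell c → ∃[ e ] α e ≡ c × p ≡ P e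
      ∈-cell⁻ p∈ with e , e∈ , p≡ ← ∈-map⁻ P p∈ = e , proj₂ (∈-filter⁻ _ {xs = all} e∈) , p≡

      partition : Clustering (pts space) k
      partition = record
        { cluster  = cell
        ; unique   = λ c → Uniqueₚ.map⁺ P-injective (Uniqueₚ.filter⁺ _ all-unique)
        ; nonEmpty = nonEmpty
        ; within   = λ c p∈ → let e , _ , p≡ = ∈-cell⁻ p∈ in
                              ≡.subst (_∈ map P all) (≡.sym p≡) (∈-map⁺ P (∈-all e))
        ; covers   = λ p∈ → let e , _ , p≡ = ∈-map⁻ P p∈ in
                            α e , ≡.subst (_∈ cell (α e)) (≡.sym p≡) (∈-cell⁺ e refl)
        ; disjoint = disjoint
        }
        where
        nonEmpty : ∀ c → cell c ≢ []
        nonEmpty c cell≡[] with e , αe≡c ← α-onto c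
          with () ← ≡.subst (P e ∈_) cell≡[] (∈-cell⁺ e αe≡c)

        disjoint : ∀ {p c c′} → p ∈ cell c → p ∈ cell c′ → c ≡ c′
        disjoint p∈ p∈′
          with e , refl , refl ← ∈-cell⁻ p∈ | e′ , refl , Pe≡Pe′ ← ∈-cell⁻ p∈′ =
          ≡.cong α (P-injective Pe≡Pe′)

      enumerates : ∀ {J : Set} {c} (φ : J → E) → Injective φ → (∀ j → α (φ j) ≡ c) →
                   (∀ e → α e ≡ c → ∃[ j ] φ j ≡ e) → Enumerates (P ∘ φ) (cell c)
      enumerates φ φ-inj φ-in φ-onto = record
        { member    = λ j → ∈-cell⁺ (φ j) (φ-in j)
        ; onto      = λ p∈ → let e , αe≡c , p≡ = ∈-cell⁻ p∈ ; j , φj≡e = φ-onto e αe≡c in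
                             j , ≡.trans (≡.cong P φj≡e) (≡.sym p≡)
        ; injective = φ-inj ∘ P-injective
        }

    module _ {k : ℕ} {α β : E → Fin k}
             (α-onto : ∀ c → ∃[ e ] α e ≡ c) (β-onto : ∀ c → ∃[ e ] β e ≡ c) where

      private
        module A = Partition α α-onto
        module B = Partition β β-onto

      -- A point determines its index, hence its old and its new cluster, so the condition on all
      -- triples of a point and two clusters becomes one inequality per index.
      lloydImprovement :
        (center : Center) (κ : Fin k → E) →
        (∀ c → center (clusterSpace space A.partition c) (P (κ c))) →
        (∀ c → β (κ c) ≡ c) → (∀ e → δ e (κ (β e)) ≤ δ e (κ (α e))) →
        LloydImprovement center space B.partition A.partition
      lloydImprovement center κ κ-center κ∈B closer =
        P ∘ κ , κ-center , (λ c → B.∈-cell⁺ (κ c) (κ∈B c)) , moves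
        where
        moves : ∀ {p c c′} → p ∈ A.cell c → p ∈ B.cell c′ →
                dist space p (P (κ c′)) ≤ dist space p (P (κ c))
        moves p∈A p∈B
          with e , refl , refl ← A.∈-cell⁻ p∈A | e′ , refl , Pe≡Pe′ ← B.∈-cell⁻ p∈B
          with refl ← P-injective Pe≡Pe′ =
          ≡.subst₂ _≤_ (≡.sym (dist-P e (κ (β e)))) (≡.sym (dist-P e (κ (α e)))) (closer e)

∈⇒≢[] : {A : Set} {a : A} {xs : List A} → a ∈ xs → xs ≢ []
∈⇒≢[] () refl

1<1+n : ∀ {n} → Fin n → 1 ℕ.< suc n
1<1+n {suc n} _ = ℕ.s≤s (ℕ.s≤s ℕ.z≤n)

-- Scores of one and two points, and the exchange between the two clusterings.

module Objective
  (𝓡 : RealNumbers) (Point L : Set) (_≟_ : DecidableEquality Point)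
  (inexhaustible : Inexhaustible Point)
  (𝓟 : CenterBasedClustering.PolynomialTime 𝓡 Point L)
  (H : CenterBasedClustering.UniversalObjective 𝓡 Point L 𝓟) where

  open CenterBasedClustering 𝓡 Point L
  open OrderedField 𝓡
  open Spaces 𝓡 Point L _≟_
  open UniversalObjective H
  open IsCenterAssignment isCenterAssignment

  alg : ⟦ list lbl ⊗ list (list real) ⟧ → ℝ
  alg = proj₁ score-poly

  -- Running the scoring algorithm on an encoding, instead of scoring a chosen space, needs no
  -- choice of points and makes `σ` and `π` computable from labels. For `π` the matrix encodes a
  -- metric space only if the distance is positive.
  σ : L → ℝ
  σ l = alg (l ∷ [] , (0# ∷ []) ∷ [])

  π : L → ℝ → ℝ
  π l r = alg (l ∷ l ∷ [] , (0# ∷ r ∷ []) ∷ (r ∷ 0# ∷ []) ∷ [])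

  module _ (l : L) {r : ℝ} (r>0 : Positive r) where

    open Uniform r r>0 l

    score-uniform₁ : ∀ p → score (uniform (p ∷ []) ([] ∷ [])) ≈ σ l
    score-uniform₁ p = Eq.trans (proj₂ (proj₂ score-poly) _ (λ ()))
      (Eq.reflexive (≡.cong (λ s → alg (l ∷ [] , (s ∷ []) ∷ [])) (uniform-self p)))

    score-uniform₂ : ∀ {p q} (u : Unique (p ∷ q ∷ [])) → p ≢ q →
                     score (uniform (p ∷ q ∷ []) u) ≈ π l r
    score-uniform₂ {p} {q} u p≢q = Eq.trans (proj₂ (proj₂ score-poly) _ (λ ()))
      (Eq.reflexive (≡.cong₂ (λ R S → alg (l ∷ l ∷ [] , R ∷ S ∷ []))
        (≡.cong₂ (λ s t → s ∷ t ∷ []) (uniform-self p) (uniform-≢ p≢q))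
        (≡.cong₂ (λ s t → s ∷ t ∷ []) (uniform-≢ (p≢q ∘ ≡.sym)) (uniform-self q))))

  score-singleton : ∀ T {l} {x : ⊤ → Point} → Enumerates x (pts T) →
                    label T (x tt) ≡ l → score T ≈ σ l
  score-singleton T {l} {x} enum label≡l =
    Eq.trans (score-≅ {T} (∈⇒≢[] (member tt)) T≅U) (score-uniform₁ l r>0 p)
    where
    open Enumerates enum
    p   = x tt
    r>0 = proj₂ ∃-positive
    open Uniform _ r>0 l
    T≅U : T ≅ uniform (p ∷ []) ([] ∷ [])
    T≅U = enumerated-≅ T _ enum singleton-enumerates
      (λ _ _ → Eq.trans (dist-self T (member tt)) (Eq.reflexive (≡.sym (uniform-self p))))
      (λ _ → label≡l)

  uniform-pair : ∀ {p q} → p ≢ q → (l : L) {r : ℝ} → Positive r → Space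
  uniform-pair {p} {q} p≢q l r>0 =
    Uniform.uniform _ r>0 l (p ∷ q ∷ []) ((p≢q ∷ []) ∷ [] ∷ [])

  pair-dist : ∀ T l {r} {x : Bool → Point} {p q} (p≢q : p ≢ q) (r>0 : Positive r) →
              Enumerates x (pts T) → dist T (x false) (x true) ≈ r →
              {y : Bool → Point} → Enumerates y (p ∷ q ∷ []) →
              ∀ b b′ → dist T (x b) (x b′) ≈ dist (uniform-pair p≢q l r>0) (y b) (y b′)
  pair-dist T l {r} {x} p≢q r>0 enum dist≈r {y} y-enum = eq
    where
    open Enumerates enum
    open Uniform r r>0 l
    U = uniform-pair p≢q l r>0

    diagonal : ∀ b → dist T (x b) (x b) ≈ dist U (y b) (y b)
    diagonal b = Eq.trans (dist-self T (member b)) (Eq.reflexive (≡.sym (uniform-self (y b))))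

    yf≢yt : y false ≢ y true
    yf≢yt eq with () ← Enumerates.injective y-enum eq

    eq : ∀ b b′ → dist T (x b) (x b′) ≈ dist U (y b) (y b′)
    eq false false = diagonal false
    eq true  true  = diagonal true
    eq false true  = Eq.trans dist≈r (Eq.reflexive (≡.sym (uniform-≢ yf≢yt)))
    eq true  false = Eq.trans (IsMetric.symmetric (isMetric T) (member true) (member false))
      (Eq.trans dist≈r (Eq.reflexive (≡.sym (uniform-≢ (yf≢yt ∘ ≡.sym)))))

  score-pair : ∀ T {l r} {x : Bool → Point} → Positive r → Enumerates x (pts T) →
               (∀ b → label T (x b) ≡ l) → dist T (x false) (x true) ≈ r →
               score T ≈ π l r
  score-pair T {l} {r} {x} r>0 enum label≡l dist≈r =
    Eq.trans (score-≅ {T} {uniform-pair xf≢xt l r>0} (∈⇒≢[] (member true))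
               (enumerated-≅ T (uniform-pair xf≢xt l r>0) enum y-enum
                 (pair-dist T l xf≢xt r>0 enum dist≈r y-enum) label≡l))
             (score-uniform₂ l r>0 ((xf≢xt ∷ []) ∷ [] ∷ []) xf≢xt)
    where
    open Enumerates enum
    xf≢xt : x false ≢ x true
    xf≢xt eq with () ← injective eq
    y-enum = pair-enumerates xf≢xt

  center-singleton : ∀ T {x : ⊤ → Point} → Enumerates x (pts T) → center T (x tt)
  center-singleton T {x} enum with c , c-center ← nonEmpty {T} (∈⇒≢[] (Enumerates.member enum tt))
    with _ , xtt≡c ← Enumerates.onto enum (inside c-center) =
    ≡.subst (center T) (≡.sym xtt≡c) c-center

  -- The twin P (i , true) of a point P (i , false) is attached to it by an edge
  -- of length h i.
  module Exchange
    (S : Space) {n : ℕ} {x : Fin n → Point} (x-enum : Enumerates x (pts S))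
    (j : Fin n) (h : Fin n → ℝ) (h>0 : ∀ i → Positive (h i))
    (P : Fin n × Bool → Point) (P-injective : Injective P) where

    height : Fin n × Bool → ℝ
    height (i , false) = 0#
    height (i , true)  = h i

    0≤height : ∀ e → 0# ≤ height e
    0≤height (i , false) = ≤-refl
    0≤height (i , true)  = positive⇒0≤ (h>0 i)

    open Discrete (≡-dec _≟ᶠ_ _≟ᵇ_) (λ e e′ → height e + height e′)

    abstract

      -- All edges are joined at their base ends, so distinct base indices are at distance 0 and
      -- `hair` is only a pseudometric. Added to the metric of `S`, it leaves that metric unchanged
      -- on the base points.
      hair : Fin n × Bool → Fin n × Bool → ℝ
      hair = discrete

      hair-pseudo : IsPseudometric hair
      hair-pseudo = isPseudometric
        (λ e e′ → 0≤-+ (0≤height e) (0≤height e′)) (λ _ _ → +-comm _ _)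
        (λ e e′ e″ → +-mono-≤ (a≤a+b (0≤height e′)) (a≤b+a (0≤height e′)))

      hair-twin : ∀ i → hair (i , false) (i , true) ≈ h i
      hair-twin i = Eq.trans (Eq.reflexive (discrete-≢ {i , false} {i , true} λ ())) (+-identityˡ (h i))

      hair-near : ∀ i i′ → hair (i , false) (i′ , false) ≈ 0#
      hair-near i i′ = discrete-≈0 {i , false} {i′ , false} (+-identityˡ 0#)

    open Doubling S x-enum j P P-injective hair hair-pseudo
      (λ i ε≈0 → h>0 i (≤-reflexive (Eq.trans (Eq.sym (hair-twin i)) ε≈0)))
      public

    l : Fin n → L
    l i = label S (x i)

    δ-near : ∀ i i′ → δ (i , false) (i′ , false) ≈ dist S (x i) (x i′)
    δ-near i i′ = Eq.trans (+-congˡ (hair-near i i′)) (+-identityʳ _)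

    δ-twin : ∀ i → δ (i , false) (i , true) ≈ h i
    δ-twin i = Eq.trans (+-cong (dist-self S (Enumerates.member x-enum i)) (hair-twin i))
                        (+-identityˡ (h i))

    -- Cluster `zero` is C or the lone center, and cluster `suc i` belongs to the twin of i. The
    -- center j receives a twin as well, alone in both clusterings: it makes the numbering uniform
    -- and ensures at least two clusters even if C is a singleton.
    whole star : E → Fin (suc n)
    whole (i , false) = zero
    whole (i , true)  = suc i
    star (i , false) = if does (i ≟ᶠ j) then zero else suc i
    star (i , true)  = suc i

    star-j : star (j , false) ≡ zero
    star-j with j ≟ᶠ j
    ... | yes _   = refl
    ... | no  j≢j = ⊥-elim (j≢j refl)

    star-≢ : ∀ {i} → i ≢ j → star (i , false) ≡ suc i
    star-≢ {i} i≢j with i ≟ᶠ j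
    ... | yes i≡j = ⊥-elim (i≢j i≡j)
    ... | no  _   = refl

    star-elim : ∀ {i} (Q : Fin (suc n) → Set) → (i ≡ j → Q zero) → (i ≢ j → Q (suc i)) →
                Q (star (i , false))
    star-elim {i} Q on-≡ on-≢ with i ≟ᶠ j
    ... | yes i≡j = on-≡ i≡j
    ... | no  i≢j = on-≢ i≢j

    -- A Lloyd's improvement keeps each old center in the cluster of the same number; `κ` is a
    -- section of both `whole` and `star`, so one choice of centers serves in both directions.
    κ : Fin (suc n) → E
    κ zero    = j , false
    κ (suc i) = i , true

    whole-κ : ∀ c → whole (κ c) ≡ c
    whole-κ zero    = refl
    whole-κ (suc _) = refl

    star-κ : ∀ c → star (κ c) ≡ c
    star-κ zero    = star-j
    star-κ (suc _) = refl

    module Whole = Partition whole (λ c → κ c , whole-κ c)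
    module Star  = Partition star (λ c → κ c , star-κ c)

    whole-base-enumerates : Enumerates (λ i → P (i , false)) (Whole.cell zero)
    whole-base-enumerates = Whole.enumerates (_, false) (λ { refl → refl }) (λ _ → refl)
      λ { (i , false) _ → i , refl ; (_ , true) () }

    whole-twin-enumerates : ∀ i → Enumerates {⊤} (λ _ → P (i , true)) (Whole.cell (suc i))
    whole-twin-enumerates i = Whole.enumerates (λ _ → i , true) (λ _ → refl) (λ _ → refl)
      λ { (_ , false) () ; (_ , true) refl → tt , refl }

    star-center-enumerates : Enumerates {⊤} (λ _ → P (j , false)) (Star.cell zero)
    star-center-enumerates = Star.enumerates (λ _ → j , false) (λ _ → refl) (λ _ → star-j) onto
      where
      onto : ∀ e → star e ≡ zero → ∃[ _ ] (j , false) ≡ e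
      onto (i , false) eq with yes refl ← i ≟ᶠ j = tt , refl

    star-lone-enumerates : Enumerates {⊤} (λ _ → P (j , true)) (Star.cell (suc j))
    star-lone-enumerates = Star.enumerates (λ _ → j , true) (λ _ → refl) (λ _ → refl) onto
      where
      onto : ∀ e → star e ≡ suc j → ∃[ _ ] (j , true) ≡ e
      onto (i , true)  refl = tt , refl
      onto (i , false) eq with i ≟ᶠ j
      onto (i , false) ()   | yes _
      onto (i , false) refl | no i≢j = ⊥-elim (i≢j refl)

    star-pair-enumerates : ∀ {i} → i ≢ j →
                           Enumerates (λ b → P (i , b)) (Star.cell (suc i))
    star-pair-enumerates {i} i≢j = Star.enumerates (i ,_) (λ { refl → refl })
      (λ { false → star-≢ i≢j ; true → refl }) onto
      where
      onto : ∀ e → star e ≡ suc i → ∃[ b ] (i , b) ≡ e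
      onto (i′ , true)  refl = true , refl
      onto (i′ , false) eq with i′ ≟ᶠ j
      onto (i′ , false) ()   | yes _
      onto (i′ , false) refl | no _ = false , refl

    score-whole-base : score (clusterSpace space Whole.partition zero) ≈ score S
    score-whole-base = Eq.sym (score-≅ {S} (∈⇒≢[] (Enumerates.member x-enum j))
      (enumerated-≅ S (clusterSpace space Whole.partition zero) x-enum whole-base-enumerates
        (λ i i′ → Eq.trans (Eq.sym (δ-near i i′)) (Eq.reflexive (≡.sym (dist-P _ _))))
        (λ i → ≡.sym (label-P (i , false)))))

    score-whole-twin : ∀ i → score (clusterSpace space Whole.partition (suc i)) ≈ σ (l i)
    score-whole-twin i = score-singleton (clusterSpace space Whole.partition (suc i)) (whole-twin-enumerates i) (label-P (i , true))

    score-star-center : score (clusterSpace space Star.partition zero) ≈ σ (l j)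
    score-star-center = score-singleton (clusterSpace space Star.partition zero) star-center-enumerates (label-P (j , false))

    score-star-lone : score (clusterSpace space Star.partition (suc j)) ≈ σ (l j)
    score-star-lone = score-singleton (clusterSpace space Star.partition (suc j)) star-lone-enumerates (label-P (j , true))

    score-star-pair : ∀ {i} → i ≢ j →
                      score (clusterSpace space Star.partition (suc i)) ≈ π (l i) (h i)
    score-star-pair {i} i≢j = score-pair (clusterSpace space Star.partition (suc i)) (h>0 i) (star-pair-enumerates i≢j)
      (λ b → label-P (i , b)) (Eq.trans (Eq.reflexive (dist-P _ _)) (δ-twin i))

    -- Only the base points i ≠ j move, from a center at distance `dist S (x i) (x j)` to one at
    -- distance `h i`. The other clusters of `whole` are singletons, whose centers are forced.
    lloyd-whole→star :
      center (clusterSpace space Whole.partition zero) (P (j , false)) →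
      (∀ {i} → i ≢ j → h i ≤ dist S (x i) (x j)) →
      cost space Star.partition ≤ cost space Whole.partition
    lloyd-whole→star j-center h≤d = lloyd space (1<1+n j) Star.partition Whole.partition
      (lloydImprovement (λ c → κ c , whole-κ c) (λ c → κ c , star-κ c) center κ centers star-κ closer)
      where
      centers : ∀ c → center (clusterSpace space Whole.partition c) (P (κ c))
      centers zero    = j-center
      centers (suc i) = center-singleton (clusterSpace space Whole.partition (suc i)) (whole-twin-enumerates i)

      closer : ∀ e → δ e (κ (star e)) ≤ δ e (κ (whole e))
      closer (i , true)  = ≤-refl
      closer (i , false) = star-elim (λ c → δ (i , false) (κ c) ≤ δ (i , false) (j , false))
        (λ { refl → ≤-refl })
        (λ i≢j → ≤-trans (≤-reflexive (δ-twin i)) (≤-trans (h≤d i≢j)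
                   (≤-reflexive (Eq.sym (δ-near i j)))))

    -- The base points i ≠ j move back from their twins to `x j`. Both copies of j are alone in
    -- their clusters of `star`, so only genuine pairs need a hypothesis on centers.
    lloyd-star→whole :
      (∀ {i} → i ≢ j → center (clusterSpace space Star.partition (suc i)) (P (i , true))) →
      (∀ {i} → i ≢ j → dist S (x i) (x j) ≤ h i) →
      cost space Whole.partition ≤ cost space Star.partition
    lloyd-star→whole twin-center d≤h = lloyd space (1<1+n j) Whole.partition Star.partition
      (lloydImprovement (λ c → κ c , star-κ c) (λ c → κ c , whole-κ c) center κ centers whole-κ closer)
      where
      centers : ∀ c → center (clusterSpace space Star.partition c) (P (κ c))
      centers zero    = center-singleton (clusterSpace space Star.partition zero) star-center-enumerates
      centers (suc i) = twins i (i ≟ᶠ j)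
        where
        twins : ∀ i → Dec (i ≡ j) →
                center (clusterSpace space Star.partition (suc i)) (P (i , true))
        twins i (yes refl) = center-singleton (clusterSpace space Star.partition (suc j)) star-lone-enumerates
        twins i (no  i≢j)  = twin-center i≢j

      closer : ∀ e → δ e (κ (whole e)) ≤ δ e (κ (star e))
      closer (i , true)  = ≤-refl
      closer (i , false) = star-elim (λ c → δ (i , false) (j , false) ≤ δ (i , false) (κ c))
        (λ { refl → ≤-refl })
        (λ i≢j → ≤-trans (≤-reflexive (δ-near i j)) (≤-trans (d≤h i≢j)
                   (≤-reflexive (Eq.sym (δ-twin i)))))

  -- Cost comparison for separable objectives, with sum and maximum treated alike as a monotone
  -- aggregate.

  module Separable
    (agg : ∀ {k} → 1 ℕ.< k → (Fin k → ℝ) → ℝ)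
    (agg-mono : ∀ {k} (1<k : 1 ℕ.< k) {φ ψ : Fin k → ℝ} → (∀ i → φ i ≤ ψ i) → agg 1<k φ ≤ agg 1<k ψ)
    (separates : ∀ X {k} (1<k : 1 ℕ.< k) (C : Clustering (pts X) k) →
                 cost X C ≈ agg 1<k (λ i → score (clusterSpace X C i)))
    where

    agg-cong : ∀ {k} (1<k : 1 ℕ.< k) {φ ψ : Fin k → ℝ} → (∀ i → φ i ≈ ψ i) → agg 1<k φ ≈ agg 1<k ψ
    agg-cong 1<k φ≈ψ = antisym (agg-mono 1<k (λ i → ≤-reflexive (φ≈ψ i)))
                               (agg-mono 1<k (λ i → ≤-reflexive (Eq.sym (φ≈ψ i))))

    module _
      (S : Space) {n : ℕ} {x : Fin n → Point} (x-enum : Enumerates x (pts S))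
      (j : Fin n) (h : Fin n → ℝ) (h>0 : ∀ i → Positive (h i))
      (b : Fin n → ℝ) (b-j : b j ≈ σ (label S (x j)))
      (b-≢ : ∀ {i} → i ≢ j → b i ≈ π (label S (x i)) (h i)) where

      private
        module X = Enumerates x-enum

        module Costs (P : Fin n × Bool → Point) (P-injective : Injective P) where
          open Exchange S x-enum j h h>0 P P-injective public

          cost-whole : cost space Whole.partition ≈ agg (1<1+n j) (score S ∷ᶠ (σ ∘ l))
          cost-whole = Eq.trans (separates space (1<1+n j) Whole.partition)
            (agg-cong (1<1+n j) λ { zero → score-whole-base ; (suc i) → score-whole-twin i })

          cost-star : cost space Star.partition ≈ agg (1<1+n j) (σ (l j) ∷ᶠ b)
          cost-star = Eq.trans (separates space (1<1+n j) Star.partition)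
            (agg-cong (1<1+n j) λ { zero → score-star-center ; (suc i) → score-star-suc i })
            where
            score-star-suc : ∀ i → score (clusterSpace space Star.partition (suc i)) ≈ b i
            score-star-suc i = by-cases (i ≟ᶠ j)
              where
              by-cases : ∀ {i} → Dec (i ≡ j) →
                         score (clusterSpace space Star.partition (suc i)) ≈ b i
              by-cases (yes refl) = Eq.trans score-star-lone (Eq.sym b-j)
              by-cases (no  i≢j)  = Eq.trans (score-star-pair i≢j) (Eq.sym (b-≢ i≢j))

      -- The base points keep their names from `S`, so that the cluster `zero` of `whole` equals `S`
      -- and inherits its center through `respects-≐`.
      star≤whole : center S (x j) → (∀ {i} → i ≢ j → h i ≤ dist S (x i) (x j)) →
                   agg (1<1+n j) (σ (label S (x j)) ∷ᶠ b) ≤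
                   agg (1<1+n j) (score S ∷ᶠ λ i → σ (label S (x i)))
      star≤whole j-center h≤d with y , y-inj , y∉S ← fresh inexhaustible n (pts S) =
        ≤-trans (≤-reflexive (Eq.sym cost-star)) (≤-trans
          (lloyd-whole→star
            (respects-≐ (enumerated-≐ S (clusterSpace space Whole.partition zero) x-enum whole-base-enumerates
              (λ i i′ → Eq.trans (Eq.sym (δ-near i i′)) (Eq.reflexive (≡.sym (dist-P _ _))))
              (λ i → ≡.sym (label-P (i , false)))) j-center) h≤d)
          (≤-reflexive cost-whole))
        where
        open Costs (join x y) (join-injective X.injective y-inj
          (λ i i′ xi≡yi′ → y∉S i′ (≡.subst (_∈ pts S) xi≡yi′ (X.member i))))

      -- Either point of a pair may be its center, so on a copy of S the twins
      -- are taken to be the centers of the pairs; Lloyd's improvement then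
      -- moves the other point of each pair to x j.
      whole≤star : (∀ {i} → i ≢ j → dist S (x i) (x j) ≤ h i) →
                   agg (1<1+n j) (score S ∷ᶠ λ i → σ (label S (x i))) ≤
                   agg (1<1+n j) (σ (label S (x j)) ∷ᶠ b)
      whole≤star d≤h
        with p , p-inj , _ ← fresh inexhaustible n []
        with q , q-inj , q∉p ← fresh inexhaustible n (tabulate p) =
        ≤-trans (≤-reflexive (Eq.sym cost-whole)) (≤-trans
          (lloyd-star→whole twin-center d≤h) (≤-reflexive cost-star))
        where
        p≢q : ∀ i i′ → p i ≢ q i′
        p≢q i i′ pi≡qi′ = q∉p i′ (≡.subst (_∈ tabulate p) pi≡qi′ (∈-tabulate⁺ i))

        pq-injective : Injective (join p q)
        pq-injective = join-injective p-inj q-inj p≢q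

        U : Fin n → Space
        U i = uniform-pair (p≢q i i) (label S (x i)) (h>0 i)

        -- The center is found first, in a uniform space on two fresh points, and the pair is then
        -- enumerated so that this center is the twin. The corresponding cluster of the star equals
        -- `U i` as a labeled space, hence has the same center.
        naming : ∀ i → ∃[ c ] center (U i) c ×
                 Σ[ y ∈ (Bool → Point) ] Enumerates y (p i ∷ q i ∷ []) × y true ≡ c
        naming i with c , c-center ← nonEmpty {U i} (λ ()) =
          c , c-center , pair-enumerates-at (p≢q i i) (inside c-center)

        P : Fin n × Bool → Point
        P (i , b) = proj₁ (proj₂ (proj₂ (naming i))) b

        P-enumerates : ∀ i → Enumerates (λ b → P (i , b)) (p i ∷ q i ∷ [])
        P-enumerates i = proj₁ (proj₂ (proj₂ (proj₂ (naming i))))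

        ∈-pair : ∀ {i y} → y ∈ p i ∷ q i ∷ [] → ∃[ b ] join p q (i , b) ≡ y
        ∈-pair (here refl)         = false , refl
        ∈-pair (there (here refl)) = true , refl

        same-pair : ∀ {i i′ y} → y ∈ p i ∷ q i ∷ [] → y ∈ p i′ ∷ q i′ ∷ [] → i ≡ i′
        same-pair y∈ y∈′ with b , eq ← ∈-pair y∈ | b′ , eq′ ← ∈-pair y∈′ =
          ≡.cong proj₁ (pq-injective {_ , b} {_ , b′} (≡.trans eq (≡.sym eq′)))

        P-injective : Injective P
        P-injective {i , b} {i′ , b′} eq = same-base
          (same-pair (Enumerates.member (P-enumerates i) b)
            (≡.subst (_∈ p i′ ∷ q i′ ∷ []) (≡.sym eq) (Enumerates.member (P-enumerates i′) b′)))
          eq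
          where
          same-base : ∀ {i i′} → i ≡ i′ → P (i , b) ≡ P (i′ , b′) → (i , b) ≡ (i′ , b′)
          same-base {i} refl eq = ≡.cong (i ,_) (Enumerates.injective (P-enumerates i) eq)

        open Costs P P-injective

        twin-center : ∀ {i} → i ≢ j →
                      center (clusterSpace space Star.partition (suc i)) (P (i , true))
        twin-center {i} i≢j = respects-≐
          (enumerated-≐ (U i) (clusterSpace space Star.partition (suc i)) (P-enumerates i) (star-pair-enumerates i≢j)
            (λ b b′ → Eq.sym (pair-dist (clusterSpace space Star.partition (suc i)) (l i) (p≢q i i) (h>0 i) (star-pair-enumerates i≢j)
              (Eq.trans (Eq.reflexive (dist-P _ _)) (δ-twin i)) (P-enumerates i) b b′))
            (λ b → ≡.sym (label-P (i , b))))
          (≡.subst (center (U i)) (≡.sym (proj₂ (proj₂ (proj₂ (proj₂ (naming i))))))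
            (proj₁ (proj₂ (naming i))))

    -- Two parallel copies of `S`, a positive distance apart, form a clustering into two clusters
    -- isomorphic to `S`. Its nonnegative cost is the aggregate of `score S` with itself.
    score-nonNegative : (∀ {s} → 0# ≤ agg {2} (1<1+n zero) (λ _ → s) → 0# ≤ s) →
                        ∀ S {c} → c ∈ pts S → 0# ≤ score S
    score-nonNegative agg-reflects S {c} c∈S
      with y , y-inj , y∉S ← fresh inexhaustible (length (pts S)) (pts S) =
      agg-reflects (≤-trans (cost-nonNegative space (1<1+n zero) Sides.partition)
        (≤-reflexive (Eq.trans (separates space (1<1+n zero) Sides.partition)
          (agg-cong (1<1+n zero) score-side))))
      where
      x      = lookup (pts S)
      x-enum = lookup-enumerates (unique S)
      module X = Enumerates x-enum
      r>0    = proj₂ ∃-positive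
      0≤r    = positive⇒0≤ r>0

      open Discrete _≟ᵇ_ (λ _ _ → proj₁ ∃-positive)

      module B = IsPseudometric (isPseudometric (λ _ _ → 0≤r) (λ _ _ → Eq.refl)
                   (λ _ _ _ → a≤a+b 0≤r))

      sides : Fin (length (pts S)) × Bool → Fin (length (pts S)) × Bool → ℝ
      sides e e′ = discrete (proj₂ e) (proj₂ e′)

      sides-pseudo : IsPseudometric sides
      sides-pseudo = record
        { nonNegative = λ s t → B.nonNegative (proj₂ s) (proj₂ t)
        ; self        = λ t → B.self (proj₂ t)
        ; symmetric   = λ s t → B.symmetric (proj₂ s) (proj₂ t)
        ; triangle    = λ s t u → B.triangle (proj₂ s) (proj₂ t) (proj₂ u)
        }

      open Doubling S x-enum (index c∈S) (join x y)
        (join-injective X.injective y-inj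
          (λ i i′ xi≡yi′ → y∉S i′ (≡.subst (_∈ pts S) xi≡yi′ (X.member i))))
        sides sides-pseudo
        (λ _ r≈0 → r>0 (≤-reflexive r≈0))

      side : E → Fin 2
      side (_ , false) = zero
      side (_ , true)  = suc zero

      bit : Fin 2 → Bool
      bit zero       = false
      bit (suc zero) = true

      side-bit : ∀ {i} c → side (i , bit c) ≡ c
      side-bit zero       = refl
      side-bit (suc zero) = refl

      module Sides = Partition side (λ c → (index c∈S , bit c) , side-bit c)

      side-enumerates : ∀ c → Enumerates (λ i → join x y (i , bit c)) (Sides.cell c)
      side-enumerates c = Sides.enumerates (_, bit c) (≡.cong proj₁) (λ _ → side-bit c) (onto c)
        where
        onto : ∀ c e → side e ≡ c → ∃[ i ] (i , bit c) ≡ e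
        onto zero       (i , false) _ = i , refl
        onto (suc zero) (i , true)  _ = i , refl

      score-side : ∀ c → score (clusterSpace space Sides.partition c) ≈ score S
      score-side c = Eq.sym (score-≅ {S} (∈⇒≢[] c∈S)
        (enumerated-≅ S (clusterSpace space Sides.partition c) x-enum (side-enumerates c)
          (λ i i′ → Eq.sym (Eq.trans (Eq.reflexive (dist-P (i , bit c) (i′ , bit c)))
            (Eq.trans (+-congˡ (B.self (bit c))) (+-identityʳ _))))
          (λ i → ≡.sym (label-P (i , bit c)))))

    private
      -- The twin of the center, where ρ vanishes, also needs a positive distance.
      spread : (S : Space) (ρ : Point → ℝ) → Fin (length (pts S)) → ℝ
      spread S ρ i with ρ (lookup (pts S) i) ≤? 0#
      ... | yes _ = proj₁ ∃-positive
      ... | no  _ = ρ (lookup (pts S) i)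

      spread>0 : ∀ S ρ i → Positive (spread S ρ i)
      spread>0 S ρ i with ρ (lookup (pts S) i) ≤? 0#
      ... | yes _   = proj₂ ∃-positive
      ... | no  ρ>0 = ρ>0

      spread-≡ : ∀ S ρ i → Positive (ρ (lookup (pts S) i)) → spread S ρ i ≡ ρ (lookup (pts S) i)
      spread-≡ S ρ i ρ>0 with ρ (lookup (pts S) i) ≤? 0#
      ... | yes ρ≤0 = ⊥-elim (ρ>0 ρ≤0)
      ... | no  _   = refl

    -- The exchange data read off from points instead of indices: `ρ u` is the length of the edge at
    -- `u`, and `β u` the score of the cluster of its twin. At `c` the twin is alone, so its cluster
    -- costs `σ` whatever the edge length.
    record Star (S : Space) (c : Point) (ρ β : Point → ℝ) : Set where
      field
        center∈  : c ∈ pts S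
        β-center : β c ≈ σ (label S c)
        ρ>0      : ∀ {u} → u ∈ pts S → u ≢ c → Positive (ρ u)
        β-pair   : ∀ {u} → u ∈ pts S → u ≢ c → β u ≈ π (label S u) (ρ u)

    module _ {S : Space} {c : Point} {ρ β : Point → ℝ} (star : Star S c ρ β) where
      open Star star
      private
        module X = Enumerates (lookup-enumerates (unique S))
        x = lookup (pts S)

        h-≡ : ∀ {i} → x i ≢ c → spread S ρ i ≡ ρ (x i)
        h-≡ {i} xi≢c = spread-≡ S ρ i (ρ>0 (X.member i) xi≢c)

        β-spread : ∀ {i} → x i ≢ c → β (x i) ≈ π (label S (x i)) (spread S ρ i)
        β-spread {i} xi≢c = Eq.trans (β-pair (X.member i) xi≢c)
          (Eq.reflexive (≡.cong (π (label S (x i))) (≡.sym (h-≡ xi≢c))))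

      center-bound : center S c → (∀ {u} → u ∈ pts S → u ≢ c → ρ u ≤ dist S u c) →
                     ∃[ 1<k ] agg 1<k (σ (label S c) ∷ᶠ (β ∘ lookup (pts S))) ≤
                              agg 1<k (score S ∷ᶠ (σ ∘ label S ∘ lookup (pts S)))
      center-bound c-center ρ≤d with j , refl ← X.onto center∈ = 1<1+n j ,
        star≤whole S (lookup-enumerates (unique S)) j (spread S ρ) (spread>0 S ρ) (β ∘ x) β-center
          (λ i≢j → β-spread (i≢j ∘ X.injective)) c-center
          (λ {i} i≢j → ≤-trans (≤-reflexive (Eq.reflexive (h-≡ (i≢j ∘ X.injective))))
                                (ρ≤d (X.member i) (i≢j ∘ X.injective)))

      point-bound : (∀ {u} → u ∈ pts S → u ≢ c → dist S u c ≤ ρ u) →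
                    ∃[ 1<k ] agg 1<k (score S ∷ᶠ (σ ∘ label S ∘ lookup (pts S))) ≤
                             agg 1<k (σ (label S c) ∷ᶠ (β ∘ lookup (pts S)))
      point-bound d≤ρ with j , refl ← X.onto center∈ = 1<1+n j ,
        whole≤star S (lookup-enumerates (unique S)) j (spread S ρ) (spread>0 S ρ) (β ∘ x) β-center
          (λ i≢j → β-spread (i≢j ∘ X.injective))
          (λ {i} i≢j → ≤-trans (d≤ρ (X.member i) (i≢j ∘ X.injective))
                                (≤-reflexive (Eq.reflexive (≡.sym (h-≡ (i≢j ∘ X.injective))))))

-- Finite sums and maxima.

module Aggregates (𝓡 : RealNumbers) (Point L : Set) where

  open CenterBasedClustering 𝓡 Point L
  open OrderedField 𝓡
  open Extrema totalOrder using (max≤v⁺; v≤max⁺)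

  ∑-mono : {A : Set} (xs : List A) {φ ψ : A → ℝ} →
           (∀ {a} → a ∈ xs → φ a ≤ ψ a) → ∑ xs φ ≤ ∑ xs ψ
  ∑-mono []       _   = ≤-refl
  ∑-mono (x ∷ xs) φ≤ψ = +-mono-≤ (φ≤ψ (here refl)) (∑-mono xs (φ≤ψ ∘ there))

  ∑-+ : {A : Set} (xs : List A) (φ ψ : A → ℝ) →
        ∑ xs (λ a → φ a + ψ a) ≈ ∑ xs φ + ∑ xs ψ
  ∑-+ []       φ ψ = Eq.sym (+-identityˡ 0#)
  ∑-+ (x ∷ xs) φ ψ = Eq.trans (+-congˡ (∑-+ xs φ ψ)) (interchange _ _ _ _)

  ∑-tabulate : {A : Set} {n : ℕ} (t : Fin n → A) (φ : A → ℝ) →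
               ∑ (tabulate t) φ ≡ ∑ (allFin n) (φ ∘ t)
  ∑-tabulate t φ = ≡.cong (foldr _+_ 0#) (≡.trans (map-tabulate t φ)
    (≡.sym (map-tabulate id (φ ∘ t))))

  -- Splits off cluster `zero` and turns the sum over the remaining cluster numbers into one over
  -- points.
  ∑-∷-lookup : {A : Set} (a : ℝ) (xs : List A) (φ : A → ℝ) →
               ∑ (allFin (suc (length xs))) (a ∷ᶠ (φ ∘ lookup xs)) ≡ a + ∑ xs φ
  ∑-∷-lookup a xs φ = ≡.cong (a +_) (≡.trans (∑-tabulate suc (a ∷ᶠ (φ ∘ lookup xs)))
    (≡.trans (≡.sym (∑-tabulate (lookup xs) φ)) (≡.cong (λ ys → ∑ ys φ) (tabulate-lookup xs))))

  max-≤ : ∀ {v b} {xs : List ℝ} → v ≤ b → (∀ {x} → x ∈ xs → x ≤ b) → max v xs ≤ b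
  max-≤ v≤b xs≤b = max≤v⁺ v≤b (All.tabulate xs≤b)

  ≤-max-∈ : ∀ {v x} {xs : List ℝ} → x ∈ xs → x ≤ max v xs
  ≤-max-∈ {v} {xs = xs} x∈ = v≤max⁺ v xs (inj₂ (lose x∈ ≤-refl))

  ≤-max-⊥ : ∀ v (xs : List ℝ) → v ≤ max v xs
  ≤-max-⊥ v xs = v≤max⁺ v xs (inj₁ ≤-refl)

  max-map-≤ : {A : Set} (xs : List A) {φ : A → ℝ} {v b : ℝ} → v ≤ b →
              (∀ {a} → a ∈ xs → φ a ≤ b) → max v (map φ xs) ≤ b
  max-map-≤ xs {φ} {b = b} v≤b φ≤b = max-≤ v≤b λ x∈ →
    let a , a∈ , x≡ = ∈-map⁻ φ x∈ in ≡.subst (_≤ b) (≡.sym x≡) (φ≤b a∈)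

  ≤-max-map : {A : Set} {a : A} (xs : List A) (φ : A → ℝ) {v : ℝ} → a ∈ xs →
              φ a ≤ max v (map φ xs)
  ≤-max-map xs φ a∈ = ≤-max-∈ (∈-map⁺ φ a∈)

  maxFin-≤ : ∀ {k} (1<k : 1 ℕ.< k) (φ : Fin k → ℝ) {b} → (∀ i → φ i ≤ b) → maxFin 1<k φ ≤ b
  maxFin-≤ {suc k} _ φ φ≤b = max-map-≤ (allFin (suc k)) (φ≤b zero) (λ {i} _ → φ≤b i)

  ≤-maxFin : ∀ {k} (1<k : 1 ℕ.< k) (φ : Fin k → ℝ) i → φ i ≤ maxFin 1<k φ
  ≤-maxFin {suc k} _ φ i = ≤-max-map (allFin (suc k)) φ (∈-allFin i)

  maxFin-mono : ∀ {k} (1<k : 1 ℕ.< k) {φ ψ : Fin k → ℝ} → (∀ i → φ i ≤ ψ i) →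
                maxFin 1<k φ ≤ maxFin 1<k ψ
  maxFin-mono 1<k {φ} {ψ} φ≤ψ = maxFin-≤ 1<k φ (λ i → ≤-trans (φ≤ψ i) (≤-maxFin 1<k ψ i))

  -- `NaturalMax` takes one maximum over all clusters at once, whereas separability yields a maximum
  -- of cluster-wise maxima; every term of either side is bounded by the other side.
  max-maxFin : {A : Set} {k : ℕ} (1<k : 1 ℕ.< k) (φ : Fin k → ℝ) (xs : Fin k → List A)
               (ψ : Fin k → A → ℝ) →
               max (maxFin 1<k φ) (concatMap (λ i → map (ψ i) (xs i)) (allFin k)) ≈
               maxFin 1<k (λ i → max (φ i) (map (ψ i) (xs i)))
  max-maxFin {A} {k} 1<k φ xs ψ = antisym
    (max-≤ (maxFin-mono 1<k (λ i → ≤-max-⊥ (φ i) (terms i))) λ x∈ →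
      let i , _ , x∈i = find (∈-concatMap⁻ terms {xs = allFin k} x∈) in
      ≤-trans (≤-max-∈ x∈i) (≤-maxFin 1<k (λ i → max (φ i) (terms i)) i))
    (maxFin-≤ 1<k (λ i → max (φ i) (terms i)) λ i → max-≤ (≤-trans (≤-maxFin 1<k φ i) (≤-max-⊥ _ (concatMap terms (allFin k)))) λ x∈ →
      ≤-max-∈ (∈-concatMap⁺ terms (lose (∈-allFin i) x∈)))
    where
    terms : Fin k → List ℝ
    terms i = map (ψ i) (xs i)

-- From the bounds on scores to representations and natural objectives.

module Representation
  (𝓡 : RealNumbers) (Point L : Set) (_≟_ : DecidableEquality Point)
  (inexhaustible : Inexhaustible Point)
  (𝓟 : CenterBasedClustering.PolynomialTime 𝓡 Point L)
  (H : CenterBasedClustering.UniversalObjective 𝓡 Point L 𝓟) where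

  open CenterBasedClustering 𝓡 Point L
  open OrderedField 𝓡
  open Spaces 𝓡 Point L _≟_
  open Aggregates 𝓡 Point L
  open UniversalObjective H
  open IsCenterAssignment isCenterAssignment
  open Objective 𝓡 Point L _≟_ inexhaustible 𝓟 H
  open PolynomialTime 𝓟 using (Poly; comp; pair; fst; snd; nil; cons; zero#; add; neg; branch)
    renaming (id to idᴾ)

  module Threshold (v : L → ℝ → ℝ) where

    -- Distance 0 occurs only between the center and itself, where the contribution has to vanish;
    -- `v` is meaningful only at positive distances. The test has the shape of `branch`, which keeps
    -- the function polynomial-time.
    threshold : L → ℝ → ℝ
    threshold l r = if does (r ≤? 0#) then 0# else v l r

    threshold-≤0 : ∀ l {r} → r ≤ 0# → threshold l r ≡ 0#
    threshold-≤0 l {r} r≤0 with r ≤? 0#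
    ... | yes _   = refl
    ... | no  r>0 = ⊥-elim (r>0 r≤0)

    threshold->0 : ∀ l {r} → Positive r → threshold l r ≡ v l r
    threshold->0 l {r} r>0 with r ≤? 0#
    ... | yes r≤0 = ⊥-elim (r>0 r≤0)
    ... | no  _   = refl

    -- Nonnegativity of `v` handles the jump from the value 0 at distance 0 to positive distances.
    threshold-mono : ∀ l → (∀ {s} → Positive s → 0# ≤ v l s) →
                     (∀ {r s} → Positive r → Positive s → r ≤ s → v l r ≤ v l s) →
                     NonDecreasing (threshold l)
    threshold-mono l 0≤v v-mono {r} {s} _ r≤s with r ≤? 0# | s ≤? 0#
    ... | yes _   | yes _   = ≤-refl
    ... | yes _   | no  s>0 = 0≤v s>0
    ... | no  r>0 | yes s≤0 = ⊥-elim (r>0 (≤-trans r≤s s≤0))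
    ... | no  r>0 | no  s>0 = v-mono r>0 s>0 r≤s

    threshold-poly : Poly {lbl ⊗ real} {real} (uncurry v) →
                     Poly {lbl ⊗ real} {real} (uncurry threshold)
    threshold-poly v-poly = branch snd zero# zero# v-poly

  dist-≤0 : ∀ S {c} → c ∈ pts S → dist S c c ≤ 0#
  dist-≤0 S c∈ = ≤-reflexive (dist-self S c∈)

  -- Some point of the pair is a center; listing that point first gives an equal space, since the
  -- order of the points carries no information.
  pair-center : ∀ l {s} (s>0 : Positive s) →
                ∃[ p ] ∃[ q ] Σ[ p≢q ∈ p ≢ q ] center (uniform-pair p≢q l s>0) p
  pair-center l {s} s>0
    with p , p∉[] ← inexhaustible []
    with q , q∉p ← inexhaustible (p ∷ [])
    with c , c-center ← nonEmpty {uniform-pair {p} {q} (λ p≡q → q∉p (here (≡.sym p≡q))) l s>0} (λ ())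
    with inside c-center
  ... | here refl         = p , q , _ , c-center
  ... | there (here refl) = q , p , q≢p , respects-≐ (record
    { pts⊆   = swap
    ; pts⊇   = swap
    ; dist≈  = λ _ _ → Eq.refl
    ; label≡ = λ _ → refl
    }) c-center
    where
    q≢p : q ≢ p
    q≢p q≡p = q∉p (here q≡p)
    swap : ∀ {x y z : Point} → z ∈ x ∷ y ∷ [] → z ∈ y ∷ x ∷ []
    swap (here refl)         = there (here refl)
    swap (there (here refl)) = here refl

  -- Since a center exists, an upper bound on the score at every point and a lower bound at every
  -- center already show that the minimum is attained, and at each center. `S` ranges over arbitrary
  -- metrics on subsets of `X`, not only over restrictions of the metric of `X`.
  represents : ∀ X (value : List Point → (Point → Point → ℝ) → Point → ℝ) →
               ((S : Space) → pts S ⊆ pts X → label S ≡ label X → pts S ≢ [] →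
                 (∀ {c} → c ∈ pts S → score S ≤ value (pts S) (dist S) c) ×
                 (∀ {c} → center S c → value (pts S) (dist S) c ≤ score S)) →
               Represents 𝓟 H X value
  represents X value bounds C u C≢[] C⊆X d m
    with c , c-center ← nonEmpty {mkSpace C u d (label X) m} C≢[] =
      ((c , inside c-center , attained c-center) , (λ _ → proj₁ (bounds S C⊆X refl C≢[]))) , attained
    where
    S = mkSpace C u d (label X) m
    attained : ∀ {c} → center S c → score S ≈ value C d c
    attained c-center
      with upper , lower ← bounds S C⊆X refl C≢[] =
      antisym (upper (inside c-center)) (lower c-center)

  σ-poly : Poly {lbl} {real} σ
  σ-poly = comp (proj₁ (proj₂ score-poly))
    (pair (comp cons (pair idᴾ nil)) (comp cons (pair (comp cons (pair zero# nil)) nil)))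

  π-poly : Poly {lbl ⊗ real} {real} (uncurry π)
  π-poly = comp (proj₁ (proj₂ score-poly))
    (pair (fst ∷ᴾ fst ∷ᴾ nil) ((zero# ∷ᴾ snd ∷ᴾ nil) ∷ᴾ (snd ∷ᴾ zero# ∷ᴾ nil) ∷ᴾ nil))
    where
    infixr 5 _∷ᴾ_
    _∷ᴾ_ : ∀ {A B} {φ : ⟦ A ⟧ → ⟦ B ⟧} {ψ : ⟦ A ⟧ → List ⟦ B ⟧} →
           Poly {A} {B} φ → Poly {A} {list B} ψ → Poly {A} {list B} (λ a → φ a ∷ ψ a)
    P ∷ᴾ Q = comp cons (pair P Q)

  -- The centers of different clusters are chosen independently and the aggregate is monotone, so
  -- cluster-wise minimizers minimize jointly.
  minimum-∀ : ∀ {k} {A : Set} (Q : Fin k → A → Set) (φ : Fin k → A → ℝ) (m : Fin k → ℝ)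
              (agg : (Fin k → ℝ) → ℝ) → (∀ {φ ψ} → (∀ i → φ i ≤ ψ i) → agg φ ≤ agg ψ) →
              (∀ i → IsMinimum (Q i) (φ i) (m i)) →
              IsMinimum (λ c → ∀ i → Q i (c i)) (λ c → agg (λ i → φ i (c i))) (agg m)
  minimum-∀ Q φ m agg agg-mono min =
    ( (λ i → proj₁ (proj₁ (min i)))
    , (λ i → proj₁ (proj₂ (proj₁ (min i))))
    , antisym (agg-mono (λ i → ≤-reflexive (proj₂ (proj₂ (proj₁ (min i))))))
              (agg-mono (λ i → ≤-reflexive (Eq.sym (proj₂ (proj₂ (proj₁ (min i)))))))
    ) , λ c c∈ → agg-mono (λ i → proj₂ (min i) (c i) (c∈ i))

  minimum-≈ : ∀ {A : Set} {Q : A → Set} {φ ψ : A → ℝ} {v w} → (∀ a → φ a ≈ ψ a) → v ≈ w →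
              IsMinimum Q φ v → IsMinimum Q ψ w
  minimum-≈ φ≈ψ v≈w ((a , Qa , v≈φa) , v≤φ) =
    (a , Qa , Eq.trans (Eq.sym v≈w) (Eq.trans v≈φa (φ≈ψ a))) ,
    λ a Qa → ≤-trans (≤-reflexive (Eq.sym v≈w)) (≤-trans (v≤φ a Qa) (≤-reflexive (φ≈ψ a)))

  cluster-minima : ∀ X {value k} → Represents 𝓟 H X value →
                   (d : Point → Point → ℝ) (m : IsMetric (pts X) d) (C : Clustering (pts X) k) →
                   ∀ i → IsMinimum (_∈ cluster C i) (value (cluster C i) d)
                           (score (clusterSpace (withMetric X d m) C i))
  cluster-minima X rep d m C i = proj₁ (rep (cluster C i) (Clustering.unique C i)
    (Clustering.nonEmpty C i) (Clustering.within C i) d (restrictMetric (Clustering.within C i) m))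

  -- Sum-objectives.

  module SumObjective (isSum : IsSumObjective) where

    open Separable (λ {k} _ → ∑ (allFin k))
      (λ {k} _ φ≤ψ → ∑-mono (allFin k) (λ {i} _ → φ≤ψ i))
      (λ X {k} 1<k C → isSum X k 1<k (dist X) (isMetric X) C)

    open Threshold (λ l r → π l r + - σ l) renaming (threshold to g)

    module _ (S : Space) {c : Point} {ρ : Point → ℝ} (c∈S : c ∈ pts S) (ρc≤0 : ρ c ≤ 0#)
             (ρ>0 : ∀ {u} → u ∈ pts S → u ≢ c → Positive (ρ u)) where

      private
        φ : Point → ℝ
        φ u = g (label S u) (ρ u)

        -- Adding `σ` back gives `σ` at the center, where `g` vanishes, and `π` elsewhere. In this
        -- form the star splits off the sum of all singleton scores, which cancels against the same
        -- sum in the whole clustering.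
        β : Point → ℝ
        β u = σ (label S u) + φ u

        star : Star S c ρ β
        star = record
          { center∈  = c∈S
          ; β-center = Eq.trans (+-congˡ (Eq.reflexive (threshold-≤0 _ ρc≤0))) (+-identityʳ _)
          ; ρ>0      = ρ>0
          ; β-pair   = λ u∈ u≢c → Eq.trans (+-congˡ (Eq.reflexive (threshold->0 (label S _) (ρ>0 u∈ u≢c))))
                                           (+-inverseˡ-cancel _ _)
          }

        star-total : ∑ (allFin (suc (length (pts S)))) (σ (label S c) ∷ᶠ (β ∘ lookup (pts S))) ≈
                (σ (label S c) + ∑ (pts S) φ) + ∑ (pts S) (σ ∘ label S)
        star-total = Eq.trans (Eq.reflexive (∑-∷-lookup _ (pts S) β))
          (Eq.trans (+-congˡ (Eq.trans (∑-+ (pts S) (σ ∘ label S) φ) (+-comm _ _)))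
                    (Eq.sym (+-assoc _ _ _)))

        whole-total : ∑ (allFin (suc (length (pts S)))) (score S ∷ᶠ (σ ∘ label S ∘ lookup (pts S))) ≈
                 score S + ∑ (pts S) (σ ∘ label S)
        whole-total = Eq.reflexive (∑-∷-lookup _ (pts S) (σ ∘ label S))

      sum≤score : center S c → (∀ {u} → u ∈ pts S → u ≢ c → ρ u ≤ dist S u c) →
                  σ (label S c) + ∑ (pts S) φ ≤ score S
      sum≤score c-center ρ≤d = +-cancelʳ-≤ _ (≤-trans (≤-reflexive (Eq.sym star-total))
        (≤-trans (proj₂ (center-bound star c-center ρ≤d)) (≤-reflexive whole-total)))

      score≤sum : (∀ {u} → u ∈ pts S → u ≢ c → dist S u c ≤ ρ u) →
                  score S ≤ σ (label S c) + ∑ (pts S) φ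
      score≤sum d≤ρ = +-cancelʳ-≤ _ (≤-trans (≤-reflexive (Eq.sym whole-total))
        (≤-trans (proj₂ (point-bound star d≤ρ)) (≤-reflexive star-total)))

    0≤score : ∀ S {c} → c ∈ pts S → 0# ≤ score S
    0≤score = score-nonNegative λ 0≤ →
      0≤a+a⇒0≤a (≤-trans 0≤ (≤-reflexive (+-congˡ (+-identityʳ _))))

    -- A large set of points at mutual distance s would have a negative score
    -- if the contribution of a point at distance s were negative.
    0≤g : ∀ l {s} → Positive s → 0# ≤ g l s
    0≤g l {s} s>0 = -a≤0⇒0≤a (archimedean {b = σ l} (λ m → - multiple m) step bounded)
      where
      open Uniform s s>0 l

      multiple : ℕ → ℝ
      multiple m = ∑ (allFin m) (λ _ → g l s)

      step : ∀ m → - multiple m + - g l s ≤ - multiple (suc m)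
      step m = ≤-reflexive (Eq.trans (-‿+-comm _ _) (-‿cong (Eq.trans (+-comm _ _)
        (+-congˡ (Eq.reflexive (≡.sym (∑-tabulate {n = m} suc (λ _ → g l s))))))))

      bounded : ∀ m → - multiple m ≤ σ l
      -- For m + 1 points at mutual distance `s`, the upper bound at one of them reads 0 ≤ σ l + m ·
      -- g l s, as that point itself contributes 0. So σ l bounds every multiple of - g l s.
      bounded m with p , p-inj , _ ← fresh inexhaustible (suc m) [] = 0≤b+a⇒-a≤b (begin
        0#                                         ≤⟨ 0≤score S c∈S ⟩
        score S                                    ≤⟨ score≤sum S c∈S (dist-≤0 S c∈S)
                                                        (λ u∈ → dist-positive S u∈ c∈S) (λ _ _ → ≤-refl) ⟩
        σ l + (φ c + ∑ others φ)                   ≤⟨ +-mono-≤ ≤-refl (+-mono-≤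
                                                        (≤-reflexive (Eq.reflexive (threshold-≤0 l (dist-≤0 S c∈S))))
                                                        (∑-mono others at-s)) ⟩
        σ l + (0# + ∑ others (λ _ → g l s))        ≈⟨ +-congˡ (+-identityˡ _) ⟩
        σ l + ∑ others (λ _ → g l s)               ≡⟨ ≡.cong (σ l +_) (∑-tabulate (p ∘ suc) _) ⟩
        σ l + multiple m                           ∎)
        where
        S : Space
        S = uniform (tabulate p) (Uniqueₚ.tabulate⁺ p-inj)

        others = tabulate (p ∘ suc)
        c      = p zero

        c∈S : c ∈ pts S
        c∈S = here refl

        φ : Point → ℝ
        φ u = g l (dist S u c)

        at-s : ∀ {u} → u ∈ others → φ u ≤ g l s
        at-s u∈ with i , refl ← ∈-tabulate⁻ u∈ = ≤-reflexive (Eq.reflexive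
          (≡.cong (g l) (uniform-≢ (λ eq → case p-inj eq of λ ()))))

    g-mono : ∀ l → NonDecreasing (g l)
    g-mono l = threshold-mono l
      (λ s>0 → ≤-trans (0≤g l s>0) (≤-reflexive (Eq.reflexive (threshold->0 l s>0)))) mono
      where
      -- A pair at distance `s` with center p is compared with a star whose edge at q has length r ≤
      -- s. The exchange still improves the cost and gives σ l + g l r ≤ π l s, where the left side
      -- is π l r.
      mono : ∀ {r s} → Positive r → Positive s → r ≤ s → π l r + - σ l ≤ π l s + - σ l
      mono {r} {s} r>0 s>0 r≤s with p , q , p≢q , p-center ← pair-center l s>0 =
        +-mono-≤ (begin
          π l r                                         ≈⟨ +-inverseˡ-cancel (σ l) (π l r) ⟨
          σ l + (π l r + - σ l)                         ≡⟨ ≡.cong (σ l +_) (threshold->0 l r>0) ⟨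
          σ l + g l r                                   ≡⟨ ≡.cong (λ t → σ l + g l t) (R.uniform-≢ (p≢q ∘ ≡.sym)) ⟨
          σ l + g l (ρ q)                               ≈⟨ +-congˡ (Eq.trans (+-identityˡ _) (+-identityʳ _)) ⟨
          σ l + (0# + (g l (ρ q) + 0#))                 ≡⟨ ≡.cong (λ t → σ l + (t + (g l (ρ q) + 0#))) (threshold-≤0 l ρp≤0) ⟨
          σ l + (g l (ρ p) + (g l (ρ q) + 0#))          ≤⟨ sum≤score S (here refl) ρp≤0
                                                             (λ _ u≢p → ≡.subst Positive (≡.sym (R.uniform-≢ u≢p)) r>0)
                                                             p-center
                                                             (λ _ u≢p → ≡.subst₂ _≤_ (≡.sym (R.uniform-≢ u≢p))
                                                               (≡.sym (S.uniform-≢ u≢p)) r≤s) ⟩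
          score S                                       ≈⟨ score-uniform₂ l s>0 _ p≢q ⟩
          π l s                                         ∎) ≤-refl
        where
        module R = Uniform r r>0 l
        module S = Uniform s s>0 l

        S : Space
        S = uniform-pair p≢q l s>0

        ρ : Point → ℝ
        ρ u = dist (uniform-pair p≢q l r>0) u p

        ρp≤0 : ρ p ≤ 0#
        ρp≤0 = ≤-reflexive (Eq.reflexive (R.uniform-self p))

    module _ (X : Space) where

      f-at : Point → ℝ
      f-at u = σ (label X u)

      g-at : Point → ℝ → ℝ
      g-at u = g (label X u)

      representsSum : Represents 𝓟 H X (λ C d c → f-at c + ∑ C (λ x → g-at x (d x c)))
      representsSum = represents X (λ C d c → f-at c + ∑ C (λ x → g-at x (d x c))) bounds
        where
        bounds : (S : Space) → pts S ⊆ pts X → label S ≡ label X → pts S ≢ [] →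
                 (∀ {c} → c ∈ pts S → score S ≤ f-at c + ∑ (pts S) (λ x → g-at x (dist S x c))) ×
                 (∀ {c} → center S c → f-at c + ∑ (pts S) (λ x → g-at x (dist S x c)) ≤ score S)
        bounds S@(mkSpace _ _ _ _ _) _ refl _ =
          (λ c∈ → score≤sum S c∈ (dist-≤0 S c∈) (λ u∈ → dist-positive S u∈ c∈) (λ _ _ → ≤-refl)) ,
          (λ c-center → let c∈ = inside c-center in
            sum≤score S c∈ (dist-≤0 S c∈) (λ u∈ → dist-positive S u∈ c∈) c-center (λ _ _ → ≤-refl))

      naturalSum : ∀ {k} (1<k : 1 ℕ.< k) → IsNatural 𝓟 cost X k 1<k
      naturalSum {k} 1<k =
        f-at , g-at , (σ , σ-poly , λ _ → Eq.refl) ,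
        (uncurry g , threshold-poly (comp add (pair π-poly (comp neg (comp σ-poly fst)))) ,
          λ _ _ → Eq.refl) ,
        (λ {u} _ → g-mono (label X u)) ,
        inj₁ λ d m C → minimum-≈ (λ _ → Eq.refl) (Eq.sym (isSum X k 1<k d m C))
          (minimum-∀ _ _ _ (∑ (allFin k)) (λ φ≤ψ → ∑-mono (allFin k) (λ {i} _ → φ≤ψ i))
            (cluster-minima X representsSum d m C))

  -- Max-objectives whose singletons cost 0.

  module MaxObjective (isMax : IsMaxObjective) where

    open Separable maxFin maxFin-mono (λ X {k} 1<k C → isMax X k 1<k (dist X) (isMetric X) C)

    open Threshold π renaming (threshold to g)

    0≤score : ∀ S {c} → c ∈ pts S → 0# ≤ score S
    0≤score = score-nonNegative λ {s} 0≤ → ≤-trans 0≤ (maxFin-≤ {2} (1<1+n zero) (λ _ → s) (λ _ → ≤-refl))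

    module _ (S : Space) {c : Point} {ρ : Point → ℝ} (c∈S : c ∈ pts S) (ρc≤0 : ρ c ≤ 0#)
             (ρ>0 : ∀ {u} → u ∈ pts S → u ≢ c → Positive (ρ u))
             (σ≈0 : ∀ {u} → u ∈ pts S → σ (label S u) ≈ 0#) where

      private
        φ : Point → ℝ
        φ u = g (label S u) (ρ u)

        star : Star S c ρ φ
        star = record
          { center∈  = c∈S
          ; β-center = Eq.trans (Eq.reflexive (threshold-≤0 _ ρc≤0)) (Eq.sym (σ≈0 c∈S))
          ; ρ>0      = ρ>0
          ; β-pair   = λ u∈ u≢c → Eq.reflexive (threshold->0 (label S _) (ρ>0 u∈ u≢c))
          }

        x = lookup (pts S)

      -- Nothing can be cancelled from a maximum. Instead, since singletons cost 0 and `score S` is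
      -- nonnegative, the maximum over the whole clustering is `score S` itself, and it bounds each
      -- term of the star.
      max≤score : center S c → (∀ {u} → u ∈ pts S → u ≢ c → ρ u ≤ dist S u c) →
                  max 0# (map φ (pts S)) ≤ score S
      max≤score c-center ρ≤d with 1<k , bound ← center-bound star c-center ρ≤d =
        max-map-≤ (pts S) (0≤score S c∈S) λ u∈ → φ≤score (index u∈) (lookup-index u∈)
        where
        φ≤score : ∀ {u} i → u ≡ x i → φ u ≤ score S
        φ≤score i refl = ≤-trans (≤-maxFin 1<k (σ (label S c) ∷ᶠ (φ ∘ x)) (suc i))
          (≤-trans bound (maxFin-≤ 1<k (score S ∷ᶠ (σ ∘ label S ∘ x)) λ
            { zero    → ≤-refl
            ; (suc i) → ≤-trans (≤-reflexive (σ≈0 (∈-lookup i))) (0≤score S c∈S) }))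

      score≤max : (∀ {u} → u ∈ pts S → u ≢ c → dist S u c ≤ ρ u) →
                  score S ≤ max 0# (map φ (pts S))
      score≤max d≤ρ with 1<k , bound ← point-bound star d≤ρ =
        ≤-trans (≤-maxFin 1<k (score S ∷ᶠ (σ ∘ label S ∘ x)) zero)
          (≤-trans bound (maxFin-≤ 1<k (σ (label S c) ∷ᶠ (φ ∘ x)) λ
            { zero    → ≤-trans (≤-reflexive (σ≈0 c∈S)) (≤-max-⊥ 0# (map φ (pts S)))
            ; (suc i) → ≤-max-map (pts S) φ (∈-lookup i) }))

    g-mono : ∀ {l} → σ l ≈ 0# → NonDecreasing (g l)
    g-mono {l} σ≈0 = threshold-mono l 0≤π mono
      where
      0≤π : ∀ {s} → Positive s → 0# ≤ π l s
      0≤π s>0 with p , q , p≢q , _ ← pair-center l s>0 =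
        ≤-trans (0≤score (uniform-pair p≢q l s>0) (here refl))
                (≤-reflexive (score-uniform₂ l s>0 _ p≢q))

      -- The same shortened edge as for sums; here the term at q alone already gives π l r.
      mono : ∀ {r s} → Positive r → Positive s → r ≤ s → π l r ≤ π l s
      mono {r} {s} r>0 s>0 r≤s with p , q , p≢q , p-center ← pair-center l s>0 = begin
        π l r                             ≡⟨ threshold->0 l r>0 ⟨
        g l r                             ≡⟨ ≡.cong (g l) (R.uniform-≢ (p≢q ∘ ≡.sym)) ⟨
        g l (ρ q)                         ≤⟨ ≤-max-map (pts S) (g l ∘ ρ) (there (here refl)) ⟩
        max 0# (map (g l ∘ ρ) (pts S))    ≤⟨ max≤score S (here refl)
                                               (≤-reflexive (Eq.reflexive (R.uniform-self p)))
                                               (λ _ u≢p → ≡.subst Positive (≡.sym (R.uniform-≢ u≢p)) r>0)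
                                               (λ _ → σ≈0) p-center
                                               (λ _ u≢p → ≡.subst₂ _≤_ (≡.sym (R.uniform-≢ u≢p))
                                                 (≡.sym (S.uniform-≢ u≢p)) r≤s) ⟩
        score S                           ≈⟨ score-uniform₂ l s>0 _ p≢q ⟩
        π l s                             ∎
        where
        module R = Uniform r r>0 l
        module S = Uniform s s>0 l

        S : Space
        S = uniform-pair p≢q l s>0

        ρ : Point → ℝ
        ρ u = dist (uniform-pair p≢q l r>0) u p

    module _ (X : Space) (free : ∀ x (x∈X : x ∈ pts X) → score (singleton X x x∈X) ≈ 0#) where

      g-at : Point → ℝ → ℝ
      g-at u = g (label X u)

      -- Turns the hypothesis on the points of `X` into one on their labels, so that it applies to
      -- every metric on a subset of `X` and to the auxiliary pairs.
      σ-free : ∀ {u} → u ∈ pts X → σ (label X u) ≈ 0#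
      σ-free {u} u∈X = Eq.trans
        (Eq.sym (score-singleton (singleton X u u∈X) singleton-enumerates refl)) (free u u∈X)

      representsMax : Represents 𝓟 H X (λ C d c → max 0# (map (λ x → g-at x (d x c)) C))
      representsMax = represents X (λ C d c → max 0# (map (λ x → g-at x (d x c)) C)) bounds
        where
        bounds : (S : Space) → pts S ⊆ pts X → label S ≡ label X → pts S ≢ [] →
                 (∀ {c} → c ∈ pts S → score S ≤ max 0# (map (λ x → g-at x (dist S x c)) (pts S))) ×
                 (∀ {c} → center S c → max 0# (map (λ x → g-at x (dist S x c)) (pts S)) ≤ score S)
        bounds S@(mkSpace _ _ _ _ _) S⊆X refl _ =
          (λ c∈ → score≤max S c∈ (dist-≤0 S c∈) (λ u∈ → dist-positive S u∈ c∈) (σ-free ∘ S⊆X)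
            (λ _ _ → ≤-refl)) ,
          (λ c-center → let c∈ = inside c-center in
            max≤score S c∈ (dist-≤0 S c∈) (λ u∈ → dist-positive S u∈ c∈) (σ-free ∘ S⊆X) c-center
              (λ _ _ → ≤-refl))

      naturalMax : ∀ {k} (1<k : 1 ℕ.< k) → IsNatural 𝓟 cost X k 1<k
      naturalMax {k} 1<k =
        (λ _ → 0#) , g-at , ((λ _ → 0#) , zero# , λ _ → Eq.refl) ,
        (uncurry g , threshold-poly π-poly , λ _ _ → Eq.refl) ,
        (g-mono ∘ σ-free) ,
        inj₂ λ d m C → minimum-≈
          (λ c → Eq.sym (max-maxFin 1<k _ (cluster C) (λ i u → g-at u (d u (c i)))))
          (Eq.sym (isMax X k 1<k d m C))
          (minimum-∀ _ _ _ (maxFin 1<k) (maxFin-mono 1<k) (cluster-minima X representsMax d m C))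

theorem5p5 : (𝓡 : RealNumbers) (Point L : Set) →
    DecidableEquality Point → Inexhaustible Point →
    let open CenterBasedClustering 𝓡 Point L in
    (𝓟 : PolynomialTime) (H : UniversalObjective 𝓟) →
    let open UniversalObjective H in
    (X : Space) (k : ℕ) (1<k : 1 ℕ.< k) →
    (IsSumObjective →
    (Σ[ f ∈ (Point → ℝ) ] Σ[ g ∈ (Point → ℝ → ℝ) ]
    (∀ {x} → x ∈ pts X → NonDecreasing (g x)) ×
    Represents 𝓟 H X (λ C d c → f c + ∑ C (λ x → g x (d x c)))) ×
    IsNatural 𝓟 cost X k 1<k)
    ×
    (IsMaxObjective →
    (∀ x (x∈X : x ∈ pts X) → score (singleton X x x∈X) ≈ 0#) →
    (Σ[ f ∈ (Point → ℝ) ] Σ[ g ∈ (Point → ℝ → ℝ) ]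
    (∀ {x} → x ∈ pts X → NonDecreasing (g x)) ×
    Represents 𝓟 H X (λ C d c → max (f c) (map (λ x → g x (d x c)) C))) ×
    IsNatural 𝓟 cost X k 1<k)
theorem5p5 𝓡 Point L _≟_ inexhaustible 𝓟 H X k 1<k =
  (λ isSum → let open SumObjective isSum in
    (f-at X , g-at X , (λ _ → g-mono _) , representsSum X) , naturalSum X 1<k) ,
  (λ isMax free → let open MaxObjective isMax in
    ((λ _ → 0#) , g-at X free , (g-mono ∘ σ-free X free) , representsMax X free) ,
    naturalMax X free 1<k)
  where
  open RealNumbers 𝓡 using (0#)
  open Representation 𝓡 Point L _≟_ inexhaustible 𝓟 H
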